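{- Let $k\ge 2$ and $n\ge 1$ be integers and let $A\subset [k]^n$. Then for any $\epsilon>0$, there is an $M$-junta $g:[k]^n\to\{0,1\}$ such that $\|1_A-g\|_1\le\epsilon$, where $$M\le \exp\!\left(\frac{C_1|\partial A|}{k^{n-1}\epsilon}\right)$$ and $C_1$ is an absolute constant.
   Context: $[k]=\{1,\dots,k\}$. The $\ell^1$-grid $G_{k,n}$ is the graph with vertex set $[k]^n$ in which $x,y$ are adjacent iff there is $j\in[n]$ with $|x_j-y_j|=1$ and $x_i=y_i$ for all $i\ne j$. For $A\subset[k]^n$, $\partial A$ is the edge-boundary of $A$ in $G_{k,n}$, i.e. the set of edges of $G_{k,n}$ joining a point of $A$ to a point of $[k]^n\setminus A$. $1_A$ is the indicator function of $A$. For $f:[k]^n\to\mathbb{R}$, $\|f\|_1=k^{ -n}\sum_{x\in[k]^n}|f(x)|$. A function $g$ on $[k]^n$ is an $M$-junta if there is $J\subset[n]$ with $|J|=M$ such that $g(x)$ depends only on $(x_j)_{j\in J}$. -}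

module Defs where

open import Data.Nat using (ℕ; zero; suc; _+_; _*_; ∣_-_∣; _≡ᵇ_)
open import Data.Nat.ListAction using (sum)
open import Data.Bool using (Bool; true; false; if_then_else_; _∧_; not; _∨_)
open import Data.Fin using (Fin; toℕ; _≟_)
open import Data.List using (List; map; allFin)
open import Data.Bool.ListAction using (all; any)
open import Data.Vec.Functional using (_∷_)
open import Data.Fin.Subset using (Subset; _∈_; ∣_∣)
open import Relation.Nullary.Decidable using (⌊_⌋)
open import Relation.Binary.PropositionalEquality using (_≡_)

Point : ℕ → ℕ → Set
Point k n = Fin n → Fin k

sumAll : ∀ {k} n → (Point k n → ℕ) → ℕ
sumAll zero f = f (λ ())
sumAll {k} (suc n) f = sum (map (λ i → sumAll n (λ x → f (i ∷ x))) (allFin k))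

count : ∀ {k} n → (Point k n → Bool) → ℕ
count n P = sumAll n (λ x → if P x then 1 else 0)

adjacent : ∀ {k n} → Point k n → Point k n → Bool
adjacent {k} {n} x y =
  any (λ j → (∣ toℕ (x j) - toℕ (y j) ∣ ≡ᵇ 1)
             ∧ all (λ i → ⌊ i ≟ j ⌋ ∨ ⌊ x i ≟ y i ⌋) (allFin n))
      (allFin n)

-- |∂A| : number of edges of G_{k,n} joining a point of A to a point outside A.
-- Each such edge corresponds to exactly one ordered pair (x , y) with x ∈ A,
-- y ∉ A, x ~ y.
boundarySize : ∀ {k} n → (Point k n → Bool) → ℕ
boundarySize n A =
  sumAll n (λ x → count n (λ y → A x ∧ not (A y) ∧ adjacent x y))

-- Number of points where 1_A and g differ; ‖1_A - g‖₁ = disagree / k^n.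
disagree : ∀ {k} n → (Point k n → Bool) → (Point k n → Bool) → ℕ
disagree n A g = count n (λ x → not ⌊ Data.Bool._≟_ (A x) (g x) ⌋)
  where import Data.Bool

IsJunta : ∀ {k n} → ℕ → (Point k n → Bool) → Set
IsJunta {k} {n} M g =
  Data.Product.Σ (Subset n) (λ J →
    (∣ J ∣ ≡ M) Data.Product.×
    (∀ (x y : Point k n) → (∀ j → j ∈ J → x j ≡ y j) → g x ≡ g y))
  where import Data.Product

{-# OPTIONS --safe #-}
module Submission where

-- A monotone map {0,…,2^m - 1} → [k] with almost equal fibres pulls A back to a
-- Boolean function on the cube {0,1}^(nm).  The influences of the m bits encoding
-- one coordinate add up to at most a constant times the density of boundary edges
-- in that direction, uniformly in k and m.  On the cube we follow Friedgut: if J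
-- contains every coordinate of influence more than 16^(-d), then the Fourier mass
-- on sets not contained in J is at most (total influence)/(d + 1) up to a constant,
-- because mass above level d is paid for by the total influence, and mass below it
-- by the noise form of the derivatives outside J, which hypercontractivity makes
-- small.  Finally g is A with the coordinates off J frozen at a best point z, and
-- d is a multiple of |∂A| / (k^(n-1) ε).
--
-- All sums are unnormalised and roots are avoided, so that everything stays in ℤ.

open import Defs
import Data.Nat as ℕ
import Data.Nat.Properties as ℕ
open import Data.Nat using (ℕ; zero; suc)
open import Data.Nat.ListAction using (sum)
import Data.Bool as Bool
open import Data.Bool using (Bool; true; false; not; if_then_else_; _∧_; _∨_; _xor_; T)
open import Data.Bool.Properties using (T-∧; T-∨)
open import Data.Fin using (Fin; zero; suc; toℕ; _≟_; _↑ˡ_; _↑ʳ_; combine)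
open import Data.Fin.Properties using (combine-surjective)
open import Data.Fin.Subset using (Subset; ∣_∣; ⊥) renaming (_∈_ to _∈ₛ_)
open import Data.Fin.Subset.Properties using (∣⊥∣≡0)
import Data.List as List
open import Data.List using (map; allFin)
open import Data.List.Properties using (map-tabulate)
import Data.List.Relation.Unary.All as All
import Data.List.Relation.Unary.Any as Any
open import Data.List.Relation.Unary.All.Properties using (all⁺; all⁻)
open import Data.List.Relation.Unary.Any.Properties using (any⁺; any⁻)
open import Data.List.Membership.Propositional using (lose)
open import Data.List.Membership.Propositional.Properties using (∈-allFin)
open import Data.Product using (Σ; _×_; _,_; proj₁; proj₂; ∃)
open import Data.Sum using (_⊎_; inj₁; inj₂)
open import Data.Vec using (Vec; []; _∷_; here; there; updateAt; lookup; tabulate;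
  take; drop; replicate; _++_)
open import Data.Vec.Properties
  using (lookup-++ˡ; lookup-++ʳ; lookup-replicate; lookup∘tabulate)
import Data.Vec.Functional as VF
open import Function using (Equivalence; _∘_; id)
open import Relation.Nullary using (Dec; yes; no)
open import Relation.Nullary.Decidable using (⌊_⌋; toWitness; fromWitness)
open import Relation.Binary.PropositionalEquality
  using (_≡_; refl; sym; trans; cong; cong₂; subst; subst₂; module ≡-Reasoning)

-- The junta is not a rounded conditional expectation. The disagreement of `A x` with
-- `A (mix J x z)`, averaged over `x` and `z`, is exactly twice the Fourier mass off `J`, and
-- freezing the best `z` gives a function that is already Boolean.
--
-- Since `k` need not be a power of 2, the fibres differ in size by a remainder below `k`; the nth
-- power of their ratio stays below 2 only if `m` is large. So nothing may depend on `m`. For this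
-- reason influences are bounded per block of `m` bits and not bit by bit, and `J` is a set of grid
-- coordinates that enters the cube with all bits of their blocks.
--
-- Constants: passing between cube and grid costs 16, so d is about 16 |∂A| / (k^(n-1) ε). At most
-- 16^d · 4|∂A| / k^(n-1) coordinates are heavy. As 16 = 2^4, the first factor puts 4 · 16 into the
-- exponent and the second puts 4, together 68.

mix : ∀ {n} {X : Set} → Vec Bool n → Vec X n → Vec X n → Vec X n
mix [] [] [] = []
mix (j ∷ J) (x ∷ xs) (z ∷ zs) = (if j then x else z) ∷ mix J xs zs

⟦_⟧ : Bool → ℕ
⟦ b ⟧ = if b then 1 else 0

bsum : (Bool → ℕ) → ℕ
bsum f = f false ℕ.+ f true

fsum : ∀ n → (Fin n → ℕ) → ℕ
fsum zero f = 0
fsum (suc n) f = f zero ℕ.+ fsum n (λ i → f (suc i))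

vsum : ∀ {X : Set} → ((X → ℕ) → ℕ) → ∀ n → (Vec X n → ℕ) → ℕ
vsum σ zero f = f []
vsum σ (suc n) f = σ (λ x → vsum σ n (λ xs → f (x ∷ xs)))

infl : ∀ D → (Vec Bool D → Bool) → Fin D → ℕ
infl D f e = vsum bsum D (λ x → ⟦ f x xor f (updateAt x e not) ⟧)

mixDis : ∀ {X : Set} → ((X → ℕ) → ℕ) → ∀ n → Vec Bool n → (Vec X n → Bool) → ℕ
mixDis σ n J A = vsum σ n (λ x → vsum σ n (λ z → ⟦ A x xor A (mix J x z) ⟧))

^-distribʳ-* : ∀ a b n → (a ℕ.* b) ℕ.^ n ≡ a ℕ.^ n ℕ.* b ℕ.^ n
^-distribʳ-* a b zero = refl
^-distribʳ-* a b (suc n) = trans (cong (a ℕ.* b ℕ.*_) (^-distribʳ-* a b n))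
  (ℕ.[m*n]*[o*p]≡[m*o]*[n*p] a b (a ℕ.^ n) (b ℕ.^ n))

n<2^n : ∀ n → n ℕ.< 2 ℕ.^ n
n<2^n zero = ℕ.s≤s ℕ.z≤n
n<2^n (suc n) = ℕ.+-mono-≤ (ℕ.m^n>0 2 n) (ℕ.≤-trans (n<2^n n) (ℕ.m≤m+n (2 ℕ.^ n) 0))

-- Fourier analysis on the cube

module Fourier where
  open import Data.Integer using (ℤ; +_; -[1+_]; 0ℤ; 1ℤ; _+_; _*_; _-_; -_; _≤_; +≤+)
  open import Data.Integer.Properties
  open import Data.Integer.Tactic.RingSolver using (solve-∀)
  open import Data.Nat.Tactic.RingSolver using () renaming (solve-∀ to solve-∀ⁿ)

  Fn : ℕ → Set
  Fn D = Vec Bool D → ℤ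

  ∑ : ∀ D → Fn D → ℤ
  ∑ zero f = f []
  ∑ (suc D) f = ∑ D (λ x → f (false ∷ x)) + ∑ D (λ x → f (true ∷ x))

  pw : ℕ → ℕ → ℤ
  pw b D = + (b ℕ.^ D)

  pw-suc : ∀ b D → pw b (suc D) ≡ + b * pw b D
  pw-suc b D = pos-* b (b ℕ.^ D)

  -- Polynomial inequalities are certified by an explicit nonnegative slack, such as a sum of
  -- squares; what remains is an identity for the ring solver.
  ≤-by : ∀ {x y} s → 0ℤ ≤ s → x + s ≡ y → x ≤ y
  ≤-by {x} s 0≤s refl = ≤-trans (≤-reflexive (sym (+-identityʳ x))) (+-monoʳ-≤ x 0≤s)

  0≤-+ : ∀ {a b} → 0ℤ ≤ a → 0ℤ ≤ b → 0ℤ ≤ a + b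
  0≤-+ p q = +-mono-≤ p q

  0≤-* : ∀ {a b} → 0ℤ ≤ a → 0ℤ ≤ b → 0ℤ ≤ a * b
  0≤-* {+ a} {+ b} p q = subst (0ℤ ≤_) (pos-* a b) (+≤+ ℕ.z≤n)

  0≤+ : ∀ n → 0ℤ ≤ + n
  0≤+ n = +≤+ ℕ.z≤n

  0≤sq : ∀ a → 0ℤ ≤ a * a
  0≤sq (+ a) = 0≤-* {+ a} {+ a} (0≤+ a) (0≤+ a)
  0≤sq -[1+ a ] = +≤+ ℕ.z≤n

  *-monoˡ : ∀ c {x y} → 0ℤ ≤ c → x ≤ y → c * x ≤ c * y
  *-monoˡ (+ c) _ p = *-monoˡ-≤-nonNeg (+ c) p

  ∑-cong : ∀ D {f g : Fn D} → (∀ x → f x ≡ g x) → ∑ D f ≡ ∑ D g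
  ∑-cong zero p = p []
  ∑-cong (suc D) p = cong₂ _+_ (∑-cong D (λ x → p (false ∷ x))) (∑-cong D (λ x → p (true ∷ x)))

  ∑-mono : ∀ D {f g : Fn D} → (∀ x → f x ≤ g x) → ∑ D f ≤ ∑ D g
  ∑-mono zero p = p []
  ∑-mono (suc D) p = +-mono-≤ (∑-mono D (λ x → p (false ∷ x))) (∑-mono D (λ x → p (true ∷ x)))

  ∑-+ : ∀ D (f g : Fn D) → ∑ D (λ x → f x + g x) ≡ ∑ D f + ∑ D g
  ∑-+ zero f g = refl
  ∑-+ (suc D) f g = trans
    (cong₂ _+_ (∑-+ D (λ x → f (false ∷ x)) (λ x → g (false ∷ x)))
               (∑-+ D (λ x → f (true ∷ x)) (λ x → g (true ∷ x))))
    (interchange (∑ D λ x → f (false ∷ x)) _ _ _)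
    where abstract interchange : ∀ a b c d → (a + b) + (c + d) ≡ (a + c) + (b + d)
                   interchange = solve-∀

  ∑-* : ∀ D c (f : Fn D) → ∑ D (λ x → c * f x) ≡ c * ∑ D f
  ∑-* zero c f = refl
  ∑-* (suc D) c f = trans (cong₂ _+_ (∑-* D c _) (∑-* D c _)) (sym (*-distribˡ-+ c _ _))

  ∑-lin₂ : ∀ D a b (f g : Fn D) → ∑ D (λ x → a * f x + b * g x) ≡ a * ∑ D f + b * ∑ D g
  ∑-lin₂ D a b f g = trans (∑-+ D _ _) (cong₂ _+_ (∑-* D a f) (∑-* D b g))

  ∑-0 : ∀ D → ∑ D (λ _ → 0ℤ) ≡ 0ℤ
  ∑-0 zero = refl
  ∑-0 (suc D) = cong₂ _+_ (∑-0 D) (∑-0 D)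

  0≤∑ : ∀ D {f : Fn D} → (∀ x → 0ℤ ≤ f x) → 0ℤ ≤ ∑ D f
  0≤∑ D p = ≤-trans (≤-reflexive (sym (∑-0 D))) (∑-mono D p)

  ∑-const : ∀ D c → ∑ D (λ _ → c) ≡ pw 2 D * c
  ∑-const zero c = sym (*-identityˡ c)
  ∑-const (suc D) c = trans (cong₂ _+_ (∑-const D c) (∑-const D c))
    (trans (double (pw 2 D) c) (cong (_* c) (sym (pw-suc 2 D))))
    where abstract double : ∀ p c → p * c + p * c ≡ (+ 2 * p) * c
                   double = solve-∀

  -- Walsh coefficients and Parseval's identity

  even odd : ∀ {D} → Fn (suc D) → Fn D
  even f x = f (false ∷ x) + f (true ∷ x)
  odd f x = f (false ∷ x) - f (true ∷ x)

  -- Unnormalised Walsh coefficients ∑ₓ f x · (-1)^⟨S,x⟩.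
  hat : ∀ D → Fn D → Fn D
  hat zero f S = f []
  hat (suc D) f (false ∷ S) = hat D (even f) S
  hat (suc D) f (true ∷ S) = hat D (odd f) S

  hat-cong : ∀ D {f g : Fn D} → (∀ x → f x ≡ g x) → ∀ S → hat D f S ≡ hat D g S
  hat-cong zero p S = p []
  hat-cong (suc D) p (false ∷ S) = hat-cong D (λ x → cong₂ _+_ (p _) (p _)) S
  hat-cong (suc D) p (true ∷ S) = hat-cong D (λ x → cong₂ _-_ (p _) (p _)) S

  hat-* : ∀ D c (f : Fn D) S → hat D (λ x → c * f x) S ≡ c * hat D f S
  hat-* zero c f S = refl
  hat-* (suc D) c f (false ∷ S) =
    trans (hat-cong D (λ x → sym (*-distribˡ-+ c _ _)) S) (hat-* D c (even f) S)
  hat-* (suc D) c f (true ∷ S) =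
    trans (hat-cong D (λ x → distrib c _ _) S) (hat-* D c (odd f) S)
    where abstract distrib : ∀ c a b → c * a - c * b ≡ c * (a - b)
                   distrib = solve-∀

  parallelogram : ∀ D (f : Fn (suc D)) →
    ∑ D (λ x → even f x * even f x) + ∑ D (λ x → odd f x * odd f x) ≡ + 2 * ∑ (suc D) (λ x → f x * f x)
  parallelogram D f = begin
    ∑ D (λ x → even f x * even f x) + ∑ D (λ x → odd f x * odd f x)
      ≡⟨ ∑-+ D _ _ ⟨
    ∑ D (λ x → (even f x * even f x) + (odd f x * odd f x))
      ≡⟨ ∑-cong D (λ x → ident (f (false ∷ x)) (f (true ∷ x))) ⟩
    ∑ D (λ x → + 2 * ((f (false ∷ x) * f (false ∷ x)) + (f (true ∷ x) * f (true ∷ x))))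
      ≡⟨ trans (∑-* D (+ 2) _) (cong (+ 2 *_) (∑-+ D _ _)) ⟩
    + 2 * ∑ (suc D) (λ x → f x * f x) ∎
    where
      open ≡-Reasoning
      abstract ident : ∀ a b → (a + b) * (a + b) + (a - b) * (a - b) ≡ + 2 * (a * a + b * b)
               ident = solve-∀

  parseval : ∀ D f → ∑ D (λ S → hat D f S * hat D f S) ≡ pw 2 D * ∑ D (λ x → f x * f x)
  parseval zero f = sym (*-identityˡ _)
  parseval (suc D) f = begin
    ∑ D (λ S → hat D (even f) S * hat D (even f) S) + ∑ D (λ S → hat D (odd f) S * hat D (odd f) S)
      ≡⟨ cong₂ _+_ (parseval D (even f)) (parseval D (odd f)) ⟩
    pw 2 D * ∑ D (λ x → even f x * even f x) + pw 2 D * ∑ D (λ x → odd f x * odd f x)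
      ≡⟨ *-distribˡ-+ (pw 2 D) _ _ ⟨
    pw 2 D * (∑ D (λ x → even f x * even f x) + ∑ D (λ x → odd f x * odd f x))
      ≡⟨ cong (pw 2 D *_) (parallelogram D f) ⟩
    pw 2 D * (+ 2 * ∑ (suc D) (λ x → f x * f x))
      ≡⟨ assoc (pw 2 D) (∑ (suc D) (λ x → f x * f x)) ⟩
    (+ 2 * pw 2 D) * ∑ (suc D) (λ x → f x * f x)
      ≡⟨ cong (_* ∑ (suc D) (λ x → f x * f x)) (pw-suc 2 D) ⟨
    pw 2 (suc D) * ∑ (suc D) (λ x → f x * f x) ∎
    where
      open ≡-Reasoning
      abstract assoc : ∀ p s → p * (+ 2 * s) ≡ (+ 2 * p) * s
               assoc = solve-∀

  -- The noise operator and hypercontractivity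

  ∑-lin₄ : ∀ D a b c d (f g h k : Fn D) →
    ∑ D (λ x → (a * f x + b * g x) + (c * h x + d * k x)) ≡
    (a * ∑ D f + b * ∑ D g) + (c * ∑ D h + d * ∑ D k)
  ∑-lin₄ D a b c d f g h k = trans (∑-+ D (λ x → a * f x + b * g x) (λ x → c * h x + d * k x))
    (cong₂ _+_ (∑-lin₂ D a b f g) (∑-lin₂ D c d h k))

  -- 4^D times the noise operator with correlation 1/2.
  K : ∀ D → Fn D → Fn D
  K zero f x = f x
  K (suc D) f (false ∷ x) = K D (λ y → + 3 * f (false ∷ y) + 1ℤ * f (true ∷ y)) x
  K (suc D) f (true ∷ x) = K D (λ y → 1ℤ * f (false ∷ y) + + 3 * f (true ∷ y)) x

  K-cong : ∀ D {f g : Fn D} → (∀ x → f x ≡ g x) → ∀ x → K D f x ≡ K D g x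
  K-cong zero p x = p x
  K-cong (suc D) p (false ∷ x) = K-cong D (λ y → cong₂ (λ a b → + 3 * a + 1ℤ * b) (p _) (p _)) x
  K-cong (suc D) p (true ∷ x) = K-cong D (λ y → cong₂ (λ a b → 1ℤ * a + + 3 * b) (p _) (p _)) x

  private
    abstract rearrange : ∀ s t α β a b c d →
               s * (α * a + β * b) + t * (α * c + β * d) ≡ α * (s * a + t * c) + β * (s * b + t * d)
             rearrange = solve-∀

  K-lin : ∀ D α β (f g : Fn D) x →
    K D (λ y → α * f y + β * g y) x ≡ α * K D f x + β * K D g x
  K-lin zero α β f g x = refl
  K-lin (suc D) α β f g (false ∷ x) = trans
    (K-cong D (λ y → rearrange (+ 3) 1ℤ α β (f (false ∷ y)) (g (false ∷ y)) (f (true ∷ y)) (g (true ∷ y))) x)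
    (K-lin D α β (λ y → + 3 * f (false ∷ y) + 1ℤ * f (true ∷ y)) _ x)
  K-lin (suc D) α β f g (true ∷ x) = trans
    (K-cong D (λ y → rearrange 1ℤ (+ 3) α β (f (false ∷ y)) (g (false ∷ y)) (f (true ∷ y)) (g (true ∷ y))) x)
    (K-lin D α β (λ y → 1ℤ * f (false ∷ y) + + 3 * f (true ∷ y)) _ x)

  K-even : ∀ D (f : Fn (suc D)) x →
    K D (even f) x ≡ K D (λ y → f (false ∷ y)) x + K D (λ y → f (true ∷ y)) x
  K-even D f x = trans (K-cong D (λ y → unit (f (false ∷ y)) (f (true ∷ y))) x)
    (trans (K-lin D 1ℤ 1ℤ (λ y → f (false ∷ y)) (λ y → f (true ∷ y)) x)
      (sym (unit (K D (λ y → f (false ∷ y)) x) (K D (λ y → f (true ∷ y)) x))))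
    where abstract unit : ∀ a b → a + b ≡ 1ℤ * a + 1ℤ * b
                   unit = solve-∀

  K-odd : ∀ D (f : Fn (suc D)) x →
    K D (odd f) x ≡ K D (λ y → f (false ∷ y)) x - K D (λ y → f (true ∷ y)) x
  K-odd D f x = trans (K-cong D (λ y → unit (f (false ∷ y)) (f (true ∷ y))) x)
    (trans (K-lin D 1ℤ (- 1ℤ) (λ y → f (false ∷ y)) (λ y → f (true ∷ y)) x)
      (sym (unit (K D (λ y → f (false ∷ y)) x) (K D (λ y → f (true ∷ y)) x))))
    where abstract unit : ∀ a b → a - b ≡ 1ℤ * a + (- 1ℤ) * b
                   unit = solve-∀

  energy : ∀ D → Fn D → ℤ
  energy D f = ∑ D (λ x → f x * f x)

  0≤energy : ∀ D f → 0ℤ ≤ energy D f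
  0≤energy D f = 0≤∑ D (λ x → 0≤sq (f x))

  -- A two-function form of the (2,4)-hypercontractive inequality: it passes
  -- through the induction without the Cauchy–Schwarz inequality.
  hypercontractive : ∀ D (f g : Fn D) →
    ∑ D (λ x → (K D f x * K D f x) * (K D g x * K D g x)) ≤ pw 128 D * (energy D f * energy D g)
  hypercontractive zero f g = ≤-reflexive (sym (*-identityˡ _))
  hypercontractive (suc D) f g = begin
    ∑ (suc D) (λ x → (K (suc D) f x * K (suc D) f x) * (K (suc D) g x * K (suc D) g x))
      ≡⟨ ∑-+ D (λ x → (F₀ x * F₀ x) * (G₀ x * G₀ x))
                (λ x → (F₁ x * F₁ x) * (G₁ x * G₁ x)) ⟨
    ∑ D (λ x → (F₀ x * F₀ x) * (G₀ x * G₀ x)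
             + (F₁ x * F₁ x) * (G₁ x * G₁ x))
      ≤⟨ ∑-mono D pointwise ⟩
    ∑ D (λ x → (+ 32 * ((P x * P x) * (R x * R x)) + + 24 * ((P x * P x) * (S x * S x)))
             + (+ 24 * ((Q x * Q x) * (R x * R x)) + + 2 * ((Q x * Q x) * (S x * S x))))
      ≡⟨ ∑-lin₄ D (+ 32) (+ 24) (+ 24) (+ 2)
           (λ x → (P x * P x) * (R x * R x)) (λ x → (P x * P x) * (S x * S x))
           (λ x → (Q x * Q x) * (R x * R x)) (λ x → (Q x * Q x) * (S x * S x)) ⟩
    (+ 32 * ∑ D (λ x → (P x * P x) * (R x * R x)) + + 24 * ∑ D (λ x → (P x * P x) * (S x * S x))) +
    (+ 24 * ∑ D (λ x → (Q x * Q x) * (R x * R x)) + + 2 * ∑ D (λ x → (Q x * Q x) * (S x * S x)))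
      ≤⟨ +-mono-≤
           (+-mono-≤ (*-monoˡ (+ 32) (0≤+ 32) (hypercontractive D (even f) (even g)))
                     (*-monoˡ (+ 24) (0≤+ 24) (hypercontractive D (even f) (odd g))))
           (+-mono-≤ (*-monoˡ (+ 24) (0≤+ 24) (hypercontractive D (odd f) (even g)))
                     (*-monoˡ (+ 2) (0≤+ 2) (hypercontractive D (odd f) (odd g)))) ⟩
    (+ 32 * (c * (p * r)) + + 24 * (c * (p * s))) + (+ 24 * (c * (q * r)) + + 2 * (c * (q * s)))
      -- Raising all four coefficients to 32 makes the sum factor as `(p + q) * (r + s)`. Each
      -- factor is twice an energy by the parallelogram law, whence 32 · 4 = 128 per dimension.
      ≤⟨ ≤-by (c * ((+ 8 * (p * s) + + 8 * (q * r)) + + 30 * (q * s)))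
           (0≤-* (0≤+ (128 ℕ.^ D)) (0≤-+ (0≤-+ (0≤-* (0≤+ 8) (0≤-* 0≤p 0≤s)) (0≤-* (0≤+ 8) (0≤-* 0≤q 0≤r)))
                              (0≤-* (0≤+ 30) (0≤-* 0≤q 0≤s))))
           (collect c p q r s) ⟩
    + 32 * (c * ((p + q) * (r + s)))
      ≡⟨ cong₂ (λ a b → + 32 * (c * (a * b))) (parallelogram D f) (parallelogram D g) ⟩
    + 32 * (c * ((+ 2 * energy (suc D) f) * (+ 2 * energy (suc D) g)))
      ≡⟨ rescale c (energy (suc D) f) (energy (suc D) g) ⟩
    (+ 128 * c) * (energy (suc D) f * energy (suc D) g)
      ≡⟨ cong (_* (energy (suc D) f * energy (suc D) g)) (pw-suc 128 D) ⟨
    pw 128 (suc D) * (energy (suc D) f * energy (suc D) g) ∎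
    where
      open ≤-Reasoning
      P Q R S F₀ F₁ G₀ G₁ : Fn D
      F₀ x = K (suc D) f (false ∷ x)
      F₁ x = K (suc D) f (true ∷ x)
      G₀ x = K (suc D) g (false ∷ x)
      G₁ x = K (suc D) g (true ∷ x)
      P x = K D (even f) x
      Q x = K D (odd f) x
      R x = K D (even g) x
      S x = K D (odd g) x
      c = pw 128 D
      p = energy D (even f)
      q = energy D (odd f)
      r = energy D (even g)
      s = energy D (odd g)
      0≤p = 0≤energy D (even f)
      0≤q = 0≤energy D (odd f)
      0≤r = 0≤energy D (even g)
      0≤s = 0≤energy D (odd g)
      abstract collect : ∀ c p q r s →
                 ((+ 32 * (c * (p * r)) + + 24 * (c * (p * s))) + (+ 24 * (c * (q * r)) + + 2 * (c * (q * s))))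
                 + c * ((+ 8 * (p * s) + + 8 * (q * r)) + + 30 * (q * s))
                 ≡ + 32 * (c * ((p + q) * (r + s)))
               collect = solve-∀
      abstract rescale : ∀ c F G → + 32 * (c * ((+ 2 * F) * (+ 2 * G))) ≡ (+ 128 * c) * (F * G)
               rescale = solve-∀
      -- With P = a + b, Q = a - b, R = c + d, S = c - d, the first two products are (2P + Q)²(2R +
      -- S)² + (2P - Q)²(2R - S)², whose only mixed term is 32PQRS. The square 16(PS - QR)² trades
      -- it for 16(P²S² + Q²R²), which turns the coefficients 8 into 24.
      abstract complete : ∀ a b c d →
                 (((+ 3 * a + 1ℤ * b) * (+ 3 * a + 1ℤ * b)) * ((+ 3 * c + 1ℤ * d) * (+ 3 * c + 1ℤ * d))
                 + ((1ℤ * a + + 3 * b) * (1ℤ * a + + 3 * b)) * ((1ℤ * c + + 3 * d) * (1ℤ * c + + 3 * d)))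
                 + + 16 * (((a + b) * (c - d) - (a - b) * (c + d)) * ((a + b) * (c - d) - (a - b) * (c + d)))
                 ≡ (+ 32 * (((a + b) * (a + b)) * ((c + d) * (c + d))) + + 24 * (((a + b) * (a + b)) * ((c - d) * (c - d))))
                 + (+ 24 * (((a - b) * (a - b)) * ((c + d) * (c + d))) + + 2 * (((a - b) * (a - b)) * ((c - d) * (c - d))))
               complete = solve-∀
      two-point : ∀ a b c d {X Y Z W P Q R S} →
        X ≡ + 3 * a + 1ℤ * b → Y ≡ 1ℤ * a + + 3 * b →
        Z ≡ + 3 * c + 1ℤ * d → W ≡ 1ℤ * c + + 3 * d →
        P ≡ a + b → Q ≡ a - b → R ≡ c + d → S ≡ c - d →
        (X * X) * (Z * Z) + (Y * Y) * (W * W) ≤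
        (+ 32 * ((P * P) * (R * R)) + + 24 * ((P * P) * (S * S)))
        + (+ 24 * ((Q * Q) * (R * R)) + + 2 * ((Q * Q) * (S * S)))
      two-point a b c d refl refl refl refl refl refl refl refl =
        ≤-by (+ 16 * (((a + b) * (c - d) - (a - b) * (c + d)) * ((a + b) * (c - d) - (a - b) * (c + d))))
          (0≤-* {+ 16} {((a + b) * (c - d) - (a - b) * (c + d)) * ((a + b) * (c - d) - (a - b) * (c + d))}
            (0≤+ 16) (0≤sq ((a + b) * (c - d) - (a - b) * (c + d))))
          (complete a b c d)
      pointwise : ∀ x →
        (F₀ x * F₀ x) * (G₀ x * G₀ x)
        + (F₁ x * F₁ x) * (G₁ x * G₁ x)
        ≤ (+ 32 * ((P x * P x) * (R x * R x)) + + 24 * ((P x * P x) * (S x * S x)))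
        + (+ 24 * ((Q x * Q x) * (R x * R x)) + + 2 * ((Q x * Q x) * (S x * S x)))
      pointwise x = two-point (K D f₀ x) (K D f₁ x) (K D g₀ x) (K D g₁ x)
        (K-lin D (+ 3) 1ℤ f₀ f₁ x) (K-lin D 1ℤ (+ 3) f₀ f₁ x)
        (K-lin D (+ 3) 1ℤ g₀ g₁ x) (K-lin D 1ℤ (+ 3) g₀ g₁ x)
        (K-even D f x) (K-odd D f x) (K-even D g x) (K-odd D g x)
        where
          f₀ f₁ g₀ g₁ : Fn D
          f₀ y = f (false ∷ y)
          f₁ y = f (true ∷ y)
          g₀ y = g (false ∷ y)
          g₁ y = g (true ∷ y)

  -- `2 ^ (D - |S|)` without subtraction: the eigenvalue `2 ^ (2D - |S|)` of `K` on the character of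
  -- `S`, divided by the `2 ^ D` of the unnormalised Parseval identity.
  wt : ∀ {D} → Vec Bool D → ℕ
  wt [] = 1
  wt (false ∷ S) = 2 ℕ.* wt S
  wt (true ∷ S) = wt S

  noise-form : ∀ D (f : Fn D) →
    ∑ D (λ x → f x * K D f x) ≡ ∑ D (λ S → + wt S * (hat D f S * hat D f S))
  noise-form zero f = sym (*-identityˡ (f [] * f []))
  noise-form (suc D) f = begin
    ∑ (suc D) (λ x → f x * K (suc D) f x)
      ≡⟨ ∑-+ D (λ x → f (false ∷ x) * K (suc D) f (false ∷ x))
               (λ x → f (true ∷ x) * K (suc D) f (true ∷ x)) ⟨
    ∑ D (λ x → f (false ∷ x) * K (suc D) f (false ∷ x) + f (true ∷ x) * K (suc D) f (true ∷ x))
      ≡⟨ ∑-cong D (λ x → two-point (f₀ x) (f₁ x) (K D f₀ x) (K D f₁ x)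
           (K-lin D (+ 3) 1ℤ f₀ f₁ x) (K-lin D 1ℤ (+ 3) f₀ f₁ x) (K-even D f x) (K-odd D f x)) ⟩
    ∑ D (λ x → + 2 * (even f x * K D (even f) x) + 1ℤ * (odd f x * K D (odd f) x))
      ≡⟨ ∑-lin₂ D (+ 2) 1ℤ (λ x → even f x * K D (even f) x) (λ x → odd f x * K D (odd f) x) ⟩
    + 2 * ∑ D (λ x → even f x * K D (even f) x) + 1ℤ * ∑ D (λ x → odd f x * K D (odd f) x)
      ≡⟨ cong₂ (λ a b → + 2 * a + b) (noise-form D (even f))
           (trans (*-identityˡ _) (noise-form D (odd f))) ⟩
    + 2 * ∑ D (λ S → + wt S * (hat D (even f) S * hat D (even f) S))
    + ∑ D (λ S → + wt S * (hat D (odd f) S * hat D (odd f) S))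
      ≡⟨ cong (_+ ∑ D (λ S → + wt S * (hat D (odd f) S * hat D (odd f) S)))
           (trans (sym (∑-* D (+ 2) (λ S → + wt S * (hat D (even f) S * hat D (even f) S))))
             (∑-cong D (λ S → trans (sym (*-assoc (+ 2) (+ wt S) (hat D (even f) S * hat D (even f) S)))
               (cong (_* (hat D (even f) S * hat D (even f) S)) (sym (pos-* 2 (wt S))))))) ⟩
    ∑ (suc D) (λ S → + wt S * (hat (suc D) f S * hat (suc D) f S)) ∎
    where
      open ≡-Reasoning
      f₀ f₁ : Fn D
      f₀ y = f (false ∷ y)
      f₁ y = f (true ∷ y)
      abstract expand : ∀ a b c d →
                 a * (+ 3 * c + 1ℤ * d) + b * (1ℤ * c + + 3 * d)
                 ≡ + 2 * ((a + b) * (c + d)) + 1ℤ * ((a - b) * (c - d))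
               expand = solve-∀
      two-point : ∀ a b c d {X Y P Q} →
        X ≡ + 3 * c + 1ℤ * d → Y ≡ 1ℤ * c + + 3 * d → P ≡ c + d → Q ≡ c - d →
        a * X + b * Y ≡ + 2 * ((a + b) * P) + 1ℤ * ((a - b) * Q)
      two-point a b c d refl refl refl refl = expand a b c d

  -- Small-set expansion

  cancel : ∀ n .{{_ : ℕ.NonZero n}} {x y} → + n * x ≤ + n * y → x ≤ y
  cancel (suc n) {x} {y} = *-cancelˡ-≤-pos x y (+ suc n)

  pw-* : ∀ a b n → pw a n * pw b n ≡ pw (a ℕ.* b) n
  pw-* a b n = trans (sym (pos-* (a ℕ.^ n) (b ℕ.^ n))) (cong +_ (sym (^-distribʳ-* a b n)))

  data Sign : ℤ → Set where
    zero : Sign 0ℤ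
    plus : Sign 1ℤ
    minus : Sign (- 1ℤ)

  -- AM–GM in the form 4L³z ≤ 3L⁴ + z⁴ for z = t · (h · y), using h⁴ = h².
  am-gm : ∀ L t y {h} → Sign h →
    + 4 * (L * (L * (L * (t * (h * y))))) ≤
    (+ 3 * (L * (L * (L * L)))) * (h * h) + (t * (t * (t * t))) * ((y * y) * (y * y))
  am-gm L t y zero = ≤-by (((t * t) * (y * y)) * ((t * t) * (y * y))) (0≤sq ((t * t) * (y * y))) (ident L t y)
    where abstract ident : ∀ L t y → + 4 * (L * (L * (L * (t * (0ℤ * y))))) + (((t * t) * (y * y)) * ((t * t) * (y * y)))
                     ≡ (+ 3 * (L * (L * (L * L)))) * (0ℤ * 0ℤ) + (t * (t * (t * t))) * ((y * y) * (y * y))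
                   ident = solve-∀
  am-gm L t y plus = ≤-by
    (+ 2 * ((L * (L - t * y)) * (L * (L - t * y))) + ((L + t * y) * (L - t * y)) * ((L + t * y) * (L - t * y)))
    (0≤-+ (*-monoˡ (+ 2) (0≤+ 2) (0≤sq (L * (L - t * y)))) (0≤sq ((L + t * y) * (L - t * y))))
    (ident L t y)
    where abstract ident : ∀ L t y → + 4 * (L * (L * (L * (t * (1ℤ * y)))))
                     + (+ 2 * ((L * (L - t * y)) * (L * (L - t * y))) + ((L + t * y) * (L - t * y)) * ((L + t * y) * (L - t * y)))
                     ≡ (+ 3 * (L * (L * (L * L)))) * (1ℤ * 1ℤ) + (t * (t * (t * t))) * ((y * y) * (y * y))
                   ident = solve-∀
  am-gm L t y minus = ≤-by
    (+ 2 * ((L * (L + t * y)) * (L * (L + t * y))) + ((L - t * y) * (L + t * y)) * ((L - t * y) * (L + t * y)))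
    (0≤-+ (*-monoˡ (+ 2) (0≤+ 2) (0≤sq (L * (L + t * y)))) (0≤sq ((L - t * y) * (L + t * y))))
    (ident L t y)
    where abstract ident : ∀ L t y → + 4 * (L * (L * (L * (t * ((- 1ℤ) * y)))))
                     + (+ 2 * ((L * (L + t * y)) * (L * (L + t * y))) + ((L - t * y) * (L + t * y)) * ((L - t * y) * (L + t * y)))
                     ≡ (+ 3 * (L * (L * (L * L)))) * ((- 1ℤ) * (- 1ℤ)) + (t * (t * (t * t))) * ((y * y) * (y * y))
                   ident = solve-∀

  -- Replaces Hölder's inequality with exponents 4/3 and 4. If `h` is nonzero on a fraction μ of the
  -- cube, noise shrinks its quadratic form by a factor μ^(1/4); hence the density `16 ^ (-t)` in
  -- the hypothesis for a gain of `2 ^ (-t)`.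
  small-set-expansion : ∀ D t (h : Fn D) → (∀ x → Sign (h x)) →
    pw 16 t * energy D h ≤ pw 2 D →
    pw 2 t * ∑ D (λ x → h x * K D h x) ≤ pw 4 D * energy D h
  small-set-expansion D t h sign small =
    cancel (4 ℕ.^ D) (cancel (4 ℕ.^ D) (cancel (4 ℕ.^ D) (cancel 4 (begin
      + 4 * (L * (L * (L * (τ * ∑ D (λ x → h x * K D h x)))))
        ≡⟨ pull ⟩
      ∑ D (λ x → + 4 * (L * (L * (L * (τ * (h x * K D h x))))))
        ≤⟨ ∑-mono D (λ x → am-gm L τ (K D h x) (sign x)) ⟩
      ∑ D (λ x → (+ 3 * L⁴) * (h x * h x) + τ⁴ * ((K D h x * K D h x) * (K D h x * K D h x)))
        ≡⟨ ∑-lin₂ D (+ 3 * L⁴) τ⁴ (λ x → h x * h x) (λ x → (K D h x * K D h x) * (K D h x * K D h x)) ⟩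
      (+ 3 * L⁴) * p + τ⁴ * ∑ D (λ x → (K D h x * K D h x) * (K D h x * K D h x))
        ≤⟨ +-monoʳ-≤ ((+ 3 * L⁴) * p) (*-monoˡ τ⁴ 0≤τ⁴ (hypercontractive D h h)) ⟩
      (+ 3 * L⁴) * p + τ⁴ * (pw 128 D * (p * p))
        ≡⟨ cong (λ z → (+ 3 * L⁴) * p + z) (regroup τ⁴ (pw 128 D) p) ⟩
      (+ 3 * L⁴) * p + (pw 128 D * p) * (τ⁴ * p)
        -- Smallness of `h` bounds `τ⁴ * p` by `2 ^ D`, and 128 · 2 = 4⁴, so the fourth-power term
        -- becomes one more copy of `L⁴ * p` beside the three from AM-GM.
        ≤⟨ +-monoʳ-≤ ((+ 3 * L⁴) * p) (*-monoˡ (pw 128 D * p) (0≤-* (0≤+ (128 ℕ.^ D)) (0≤energy D h))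
             (≤-trans (≤-reflexive (cong (_* p) τ⁴≡)) small)) ⟩
      (+ 3 * L⁴) * p + (pw 128 D * p) * pw 2 D
        ≡⟨ cong (λ z → (+ 3 * L⁴) * p + z) (trans (swap (pw 128 D) p (pw 2 D)) (cong (_* p) L⁴≡)) ⟩
      (+ 3 * L⁴) * p + L⁴ * p
        ≡⟨ collect L p ⟩
      + 4 * (L * (L * (L * (L * p)))) ∎))))
    where
      open ≤-Reasoning
      L = pw 4 D
      τ = pw 2 t
      L⁴ = L * (L * (L * L))
      τ⁴ = τ * (τ * (τ * τ))
      p = energy D h
      instance
        4^D≢0 : ℕ.NonZero (4 ℕ.^ D)
        4^D≢0 = ℕ.m^n≢0 4 D
      fourth : ∀ a n → pw a n * (pw a n * (pw a n * pw a n)) ≡ pw (a ℕ.* (a ℕ.* (a ℕ.* a))) n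
      fourth a n = trans (cong (λ z → pw a n * (pw a n * z)) (pw-* a a n))
        (trans (cong (pw a n *_) (pw-* a (a ℕ.* a) n)) (pw-* a (a ℕ.* (a ℕ.* a)) n))
      τ⁴≡ : τ⁴ ≡ pw 16 t
      τ⁴≡ = fourth 2 t
      0≤τ⁴ : 0ℤ ≤ τ⁴
      0≤τ⁴ = ≤-trans (0≤+ (16 ℕ.^ t)) (≤-reflexive (sym τ⁴≡))
      L⁴≡ : pw 128 D * pw 2 D ≡ L⁴
      L⁴≡ = trans (pw-* 128 2 D) (sym (fourth 4 D))
      pull : + 4 * (L * (L * (L * (τ * ∑ D (λ x → h x * K D h x))))) ≡
             ∑ D (λ x → + 4 * (L * (L * (L * (τ * (h x * K D h x))))))
      pull = sym (trans (∑-* D (+ 4) _) (cong (+ 4 *_) (trans (∑-* D L _) (cong (L *_)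
             (trans (∑-* D L _) (cong (L *_) (trans (∑-* D L _) (cong (L *_) (∑-* D τ _)))))))))
      abstract
        regroup : ∀ a c p → a * (c * (p * p)) ≡ (c * p) * (a * p)
        regroup = solve-∀
        swap : ∀ c p q → (c * p) * q ≡ (c * q) * p
        swap = solve-∀
        collect : ∀ L p → (+ 3 * (L * (L * (L * L)))) * p + (L * (L * (L * L))) * p
                  ≡ + 4 * (L * (L * (L * (L * p))))
        collect = solve-∀

  -- Derivatives, and resampling outside a set of coordinates

  ∂ : ∀ {D} → Fin D → Fn D → Fn D
  ∂ e f x = f x - f (updateAt x e not)

  ι : Bool → ℤ
  ι b = + ⟦ b ⟧

  hat-∂ : ∀ D e (f : Fn D) S → hat D (∂ e f) S ≡ (+ 2 * ι (lookup S e)) * hat D f S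
  hat-∂ (suc D) zero f (false ∷ S) = trans
    (hat-cong D (λ x → ident (f (false ∷ x)) (f (true ∷ x))) S) (hat-* D (+ 2 * 0ℤ) (even f) S)
    where abstract ident : ∀ a b → (a - b) + (b - a) ≡ (+ 2 * 0ℤ) * (a + b)
                   ident = solve-∀
  hat-∂ (suc D) zero f (true ∷ S) = trans
    (hat-cong D (λ x → ident (f (false ∷ x)) (f (true ∷ x))) S) (hat-* D (+ 2 * 1ℤ) (odd f) S)
    where abstract ident : ∀ a b → (a - b) - (b - a) ≡ (+ 2 * 1ℤ) * (a - b)
                   ident = solve-∀
  hat-∂ (suc D) (suc e) f (false ∷ S) = trans
    (hat-cong D (λ x → ident (f (false ∷ x)) (f (true ∷ x)) _ _) S) (hat-∂ D e (even f) S)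
    where abstract ident : ∀ a b c d → (a - c) + (b - d) ≡ (a + b) - (c + d)
                   ident = solve-∀
  hat-∂ (suc D) (suc e) f (true ∷ S) = trans
    (hat-cong D (λ x → ident (f (false ∷ x)) (f (true ∷ x)) _ _) S) (hat-∂ D e (odd f) S)
    where abstract ident : ∀ a b c d → (a - c) - (b - d) ≡ (a - b) - (c - d)
                   ident = solve-∀

  inside : ∀ {D} → Vec Bool D → Vec Bool D → Bool
  inside [] [] = true
  inside (j ∷ J) (s ∷ S) = (not s ∨ j) ∧ inside J S

  ∑∑ : ∀ D → (Vec Bool D → Fn D) → ℤ
  ∑∑ D F = ∑ D (λ x → ∑ D (F x))

  ∑∑-cong : ∀ D {F G : Vec Bool D → Fn D} → (∀ x z → F x z ≡ G x z) → ∑∑ D F ≡ ∑∑ D G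
  ∑∑-cong D p = ∑-cong D (λ x → ∑-cong D (p x))

  ∑∑-+ : ∀ D (F G : Vec Bool D → Fn D) → ∑∑ D (λ x z → F x z + G x z) ≡ ∑∑ D F + ∑∑ D G
  ∑∑-+ D F G = trans (∑-cong D (λ x → ∑-+ D (F x) (G x))) (∑-+ D (λ x → ∑ D (F x)) (λ x → ∑ D (G x)))

  ∑∑-* : ∀ D c (F : Vec Bool D → Fn D) → ∑∑ D (λ x z → c * F x z) ≡ c * ∑∑ D F
  ∑∑-* D c F = trans (∑-cong D (λ x → ∑-* D c (F x))) (∑-* D c (λ x → ∑ D (F x)))

  ∑∑-four : ∀ D (A B C E : Vec Bool D → Fn D) →
    ∑ D (λ x → ∑ D (A x) + ∑ D (B x)) + ∑ D (λ x → ∑ D (C x) + ∑ D (E x)) ≡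
    ∑∑ D (λ x z → (A x z + B x z) + (C x z + E x z))
  ∑∑-four D A B C E = sym (trans (∑∑-+ D (λ x z → A x z + B x z) (λ x z → C x z + E x z))
    (cong₂ _+_ (∑-cong D (λ x → ∑-+ D (A x) (B x))) (∑-cong D (λ x → ∑-+ D (C x) (E x)))))

  -- Summing over `z` projects `f` onto the characters supported in `J`. At a coordinate off `J` the
  -- bits of `x` and `mix J x z` are independent, so the sum factors through `even` and the odd part
  -- dies; on `J` the bits coincide and both parts survive.
  correlation : ∀ D J (f : Fn D) →
    ∑∑ D (λ x z → f x * f (mix J x z)) ≡ ∑ D (λ S → ι (inside J S) * (hat D f S * hat D f S))
  correlation zero [] f = sym (*-identityˡ (f [] * f []))
  correlation (suc D) (true ∷ J) f = begin
    ∑∑ (suc D) (λ x z → f x * f (mix (true ∷ J) x z))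
      ≡⟨ ∑∑-four D (λ x z → f₀ x * f₀ (mix J x z)) (λ x z → f₀ x * f₀ (mix J x z))
                   (λ x z → f₁ x * f₁ (mix J x z)) (λ x z → f₁ x * f₁ (mix J x z)) ⟩
    ∑∑ D (λ x z → (f₀ x * f₀ (mix J x z) + f₀ x * f₀ (mix J x z))
                + (f₁ x * f₁ (mix J x z) + f₁ x * f₁ (mix J x z)))
      ≡⟨ ∑∑-cong D (λ x z → ident (f₀ x) (f₀ (mix J x z)) (f₁ x) (f₁ (mix J x z))) ⟩
    ∑∑ D (λ x z → even f x * even f (mix J x z) + odd f x * odd f (mix J x z))
      ≡⟨ ∑∑-+ D (λ x z → even f x * even f (mix J x z)) (λ x z → odd f x * odd f (mix J x z)) ⟩
    ∑∑ D (λ x z → even f x * even f (mix J x z)) + ∑∑ D (λ x z → odd f x * odd f (mix J x z))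
      ≡⟨ cong₂ _+_ (correlation D J (even f)) (correlation D J (odd f)) ⟩
    ∑ (suc D) (λ S → ι (inside (true ∷ J) S) * (hat (suc D) f S * hat (suc D) f S)) ∎
    where
      open ≡-Reasoning
      f₀ f₁ : Fn D
      f₀ y = f (false ∷ y)
      f₁ y = f (true ∷ y)
      abstract ident : ∀ a b c d → (a * b + a * b) + (c * d + c * d)
                                   ≡ (a + c) * (b + d) + (a - c) * (b - d)
               ident = solve-∀
  correlation (suc D) (false ∷ J) f = begin
    ∑∑ (suc D) (λ x z → f x * f (mix (false ∷ J) x z))
      ≡⟨ ∑∑-four D (λ x z → f₀ x * f₀ (mix J x z)) (λ x z → f₀ x * f₁ (mix J x z))
                   (λ x z → f₁ x * f₀ (mix J x z)) (λ x z → f₁ x * f₁ (mix J x z)) ⟩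
    ∑∑ D (λ x z → (f₀ x * f₀ (mix J x z) + f₀ x * f₁ (mix J x z))
                + (f₁ x * f₀ (mix J x z) + f₁ x * f₁ (mix J x z)))
      ≡⟨ ∑∑-cong D (λ x z → ident (f₀ x) (f₀ (mix J x z)) (f₁ x) (f₁ (mix J x z))) ⟩
    ∑∑ D (λ x z → even f x * even f (mix J x z))
      ≡⟨ correlation D J (even f) ⟩
    ∑ D (λ S → ι (inside J S) * (hat D (even f) S * hat D (even f) S))
      ≡⟨ +-identityʳ _ ⟨
    ∑ D (λ S → ι (inside J S) * (hat D (even f) S * hat D (even f) S)) + 0ℤ
      ≡⟨ cong (λ z → ∑ D (λ S → ι (inside J S) * (hat D (even f) S * hat D (even f) S)) + z)
           (sym (trans (∑-cong D (λ S → *-zeroˡ (hat D (odd f) S * hat D (odd f) S))) (∑-0 D))) ⟩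
    ∑ (suc D) (λ S → ι (inside (false ∷ J) S) * (hat (suc D) f S * hat (suc D) f S)) ∎
    where
      open ≡-Reasoning
      f₀ f₁ : Fn D
      f₀ y = f (false ∷ y)
      f₁ y = f (true ∷ y)
      abstract ident : ∀ a b c d → (a * b + a * d) + (c * b + c * d) ≡ (a + c) * (b + d)
               ident = solve-∀

  -- The map from pairs `(x , z)` to `mix J x z` is `2 ^ D` to one.
  ∑∑-mix : ∀ D J (f : Fn D) → ∑∑ D (λ x z → f (mix J x z)) ≡ pw 2 D * ∑ D f
  ∑∑-mix zero [] f = sym (*-identityˡ (f []))
  ∑∑-mix (suc D) (j ∷ J) f = trans (step j) (trans (∑∑-mix D J (λ x → + 2 * even f x))
    (trans (cong (pw 2 D *_) (trans (∑-* D (+ 2) (even f)) (cong (+ 2 *_) (∑-+ D f₀ f₁))))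
      (trans (assoc (pw 2 D) (∑ (suc D) f)) (cong (_* ∑ (suc D) f) (sym (pw-suc 2 D))))))
    where
      f₀ f₁ : Fn D
      f₀ y = f (false ∷ y)
      f₁ y = f (true ∷ y)
      abstract
        assoc : ∀ p s → p * (+ 2 * s) ≡ (+ 2 * p) * s
        assoc = solve-∀
        twice₁ : ∀ a b → (a + a) + (b + b) ≡ + 2 * (a + b)
        twice₁ = solve-∀
        twice₂ : ∀ a b → (a + b) + (a + b) ≡ + 2 * (a + b)
        twice₂ = solve-∀
      step : ∀ j → ∑∑ (suc D) (λ x z → f (mix (j ∷ J) x z)) ≡ ∑∑ D (λ x z → + 2 * even f (mix J x z))
      step true = trans (∑∑-four D (λ x z → f₀ (mix J x z)) (λ x z → f₀ (mix J x z))
                                    (λ x z → f₁ (mix J x z)) (λ x z → f₁ (mix J x z)))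
        (∑∑-cong D (λ x z → twice₁ (f₀ (mix J x z)) (f₁ (mix J x z))))
      step false = trans (∑∑-four D (λ x z → f₀ (mix J x z)) (λ x z → f₁ (mix J x z))
                                     (λ x z → f₀ (mix J x z)) (λ x z → f₁ (mix J x z)))
        (∑∑-cong D (λ x z → twice₂ (f₀ (mix J x z)) (f₁ (mix J x z))))

  dis : ∀ D → Vec Bool D → Fn D → ℤ
  dis D J f = ∑∑ D (λ x z → (f x - f (mix J x z)) * (f x - f (mix J x z)))

  -- In the expanded square both pure terms are the total Fourier mass, as `mix J x z` is uniform
  -- when `x` and `z` are, and the cross term removes twice the mass inside `J`.
  dis-spectrum : ∀ D J (f : Fn D) →
    dis D J f ≡ + 2 * ∑ D (λ S → ι (not (inside J S)) * (hat D f S * hat D f S))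
  dis-spectrum D J f = begin
    ∑∑ D (λ x z → (f x - f (mix J x z)) * (f x - f (mix J x z)))
      ≡⟨ ∑∑-cong D (λ x z → expand (f x) (f (mix J x z))) ⟩
    ∑∑ D (λ x z → (f x * f x + f (mix J x z) * f (mix J x z)) + (- (+ 2)) * (f x * f (mix J x z)))
      ≡⟨ trans (∑∑-+ D (λ x z → f x * f x + f (mix J x z) * f (mix J x z))
                   (λ x z → (- (+ 2)) * (f x * f (mix J x z))))
           (cong₂ _+_ (∑∑-+ D (λ x z → f x * f x) (λ x z → f (mix J x z) * f (mix J x z)))
             (∑∑-* D (- (+ 2)) (λ x z → f x * f (mix J x z)))) ⟩
    (∑∑ D (λ x z → f x * f x) + ∑∑ D (λ x z → f (mix J x z) * f (mix J x z)))
    + (- (+ 2)) * ∑∑ D (λ x z → f x * f (mix J x z))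
      ≡⟨ cong₂ (λ a b → a + (- (+ 2)) * b)
           (cong₂ _+_
             (trans (∑-cong D (λ x → ∑-const D (f x * f x)))
               (trans (∑-* D (pw 2 D) (λ x → f x * f x)) (sym (parseval D f))))
             (trans (∑∑-mix D J (λ x → f x * f x)) (sym (parseval D f))))
           (correlation D J f) ⟩
    (∑ D H + ∑ D H) + (- (+ 2)) * ∑ D (λ S → ι (inside J S) * H S)
      ≡⟨ trans (twice (∑ D H) (∑ D (λ S → ι (inside J S) * H S)))
           (cong (+ 2 *_) (sym (∑-lin₂ D 1ℤ (- 1ℤ) H (λ S → ι (inside J S) * H S)))) ⟩
    + 2 * ∑ D (λ S → 1ℤ * H S + (- 1ℤ) * (ι (inside J S) * H S))
      ≡⟨ cong (+ 2 *_) (∑-cong D (λ S → complement (inside J S) (H S))) ⟩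
    + 2 * ∑ D (λ S → ι (not (inside J S)) * H S) ∎
    where
      open ≡-Reasoning
      H : Fn D
      H S = hat D f S * hat D f S
      abstract
        expand : ∀ a b → (a - b) * (a - b) ≡ (a * a + b * b) + (- (+ 2)) * (a * b)
        expand = solve-∀
        twice : ∀ h k → (h + h) + (- (+ 2)) * k ≡ + 2 * (1ℤ * h + (- 1ℤ) * k)
        twice = solve-∀
        complement₁ : ∀ h → 1ℤ * h + (- 1ℤ) * (1ℤ * h) ≡ 0ℤ * h
        complement₁ = solve-∀
        complement₀ : ∀ h → 1ℤ * h + (- 1ℤ) * (0ℤ * h) ≡ 1ℤ * h
        complement₀ = solve-∀
      complement : ∀ b h → 1ℤ * h + (- 1ℤ) * (ι b * h) ≡ ι (not b) * h
      complement true = complement₁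
      complement false = complement₀

  ∑F : ∀ n → (Fin n → ℤ) → ℤ
  ∑F zero f = 0ℤ
  ∑F (suc n) f = f zero + ∑F n (λ i → f (suc i))

  ∑F-cong : ∀ n {f g : Fin n → ℤ} → (∀ i → f i ≡ g i) → ∑F n f ≡ ∑F n g
  ∑F-cong zero p = refl
  ∑F-cong (suc n) p = cong₂ _+_ (p zero) (∑F-cong n (λ i → p (suc i)))

  ∑F-mono : ∀ n {f g : Fin n → ℤ} → (∀ i → f i ≤ g i) → ∑F n f ≤ ∑F n g
  ∑F-mono zero p = ≤-refl
  ∑F-mono (suc n) p = +-mono-≤ (p zero) (∑F-mono n (λ i → p (suc i)))

  ∑F-* : ∀ n c (f : Fin n → ℤ) → ∑F n (λ i → c * f i) ≡ c * ∑F n f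
  ∑F-* zero c f = sym (*-zeroʳ c)
  ∑F-* (suc n) c f = trans (cong (λ z → c * f zero + z) (∑F-* n c (λ i → f (suc i))))
    (sym (*-distribˡ-+ c (f zero) (∑F n (λ i → f (suc i)))))

  ∑-∑F : ∀ D n (F : Fin n → Fn D) → ∑ D (λ S → ∑F n (λ i → F i S)) ≡ ∑F n (λ i → ∑ D (F i))
  ∑-∑F D zero F = ∑-0 D
  ∑-∑F D (suc n) F = trans (∑-+ D (F zero) (λ S → ∑F n (λ i → F (suc i) S)))
    (cong (λ z → ∑ D (F zero) + z) (∑-∑F D n (λ i → F (suc i))))

  -- Friedgut's argument in the spectrum

  card : ∀ {D} → Vec Bool D → ℕ
  card [] = 0
  card (s ∷ S) = ⟦ s ⟧ ℕ.+ card S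

  -- 2^(d - |S|) ≥ 1 + d - |S|, with denominators and subtractions cleared.
  level : ∀ {D} d (S : Vec Bool D) → 2 ℕ.^ D ℕ.* suc d ℕ.≤ 2 ℕ.^ D ℕ.* card S ℕ.+ 2 ℕ.^ d ℕ.* wt S
  level d [] = ℕ.≤-trans (ℕ.≤-reflexive (ℕ.*-identityˡ (suc d)))
    (ℕ.≤-trans (n<2^n d) (ℕ.≤-reflexive (sym (ℕ.*-identityʳ (2 ℕ.^ d)))))
  level {suc D} d (false ∷ S) = begin
    2 ℕ.* 2 ℕ.^ D ℕ.* suc d                                ≡⟨ ℕ.*-assoc 2 (2 ℕ.^ D) (suc d) ⟩
    2 ℕ.* (2 ℕ.^ D ℕ.* suc d)                              ≤⟨ ℕ.*-monoʳ-≤ 2 (level d S) ⟩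
    2 ℕ.* (2 ℕ.^ D ℕ.* card S ℕ.+ 2 ℕ.^ d ℕ.* wt S)        ≡⟨ ident (2 ℕ.^ D) (card S) (2 ℕ.^ d) (wt S) ⟩
    2 ℕ.* 2 ℕ.^ D ℕ.* card S ℕ.+ 2 ℕ.^ d ℕ.* (2 ℕ.* wt S)  ∎
    where
      open ℕ.≤-Reasoning
      abstract ident : ∀ P c t w → 2 ℕ.* (P ℕ.* c ℕ.+ t ℕ.* w) ≡ 2 ℕ.* P ℕ.* c ℕ.+ t ℕ.* (2 ℕ.* w)
               ident = solve-∀ⁿ
  level {suc D} zero (true ∷ S) = ℕ.≤-trans
    (ℕ.*-monoʳ-≤ (2 ℕ.^ suc D) (ℕ.s≤s ℕ.z≤n)) (ℕ.m≤m+n (2 ℕ.^ suc D ℕ.* card (true ∷ S)) (1 ℕ.* wt S))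
  level {suc D} (suc d) (true ∷ S) = begin
    2 ℕ.* 2 ℕ.^ D ℕ.* suc (suc d)
      ≡⟨ ident₁ (2 ℕ.^ D) d ⟩
    2 ℕ.* 2 ℕ.^ D ℕ.+ 2 ℕ.* (2 ℕ.^ D ℕ.* suc d)
      ≤⟨ ℕ.+-monoʳ-≤ (2 ℕ.* 2 ℕ.^ D) (ℕ.*-monoʳ-≤ 2 (level d S)) ⟩
    2 ℕ.* 2 ℕ.^ D ℕ.+ 2 ℕ.* (2 ℕ.^ D ℕ.* card S ℕ.+ 2 ℕ.^ d ℕ.* wt S)
      ≡⟨ ident₂ (2 ℕ.^ D) (card S) (2 ℕ.^ d) (wt S) ⟩
    2 ℕ.* 2 ℕ.^ D ℕ.* (1 ℕ.+ card S) ℕ.+ 2 ℕ.* 2 ℕ.^ d ℕ.* wt S ∎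
    where
      open ℕ.≤-Reasoning
      abstract
        ident₁ : ∀ P d → 2 ℕ.* P ℕ.* (2 ℕ.+ d) ≡ 2 ℕ.* P ℕ.+ 2 ℕ.* (P ℕ.* (1 ℕ.+ d))
        ident₁ = solve-∀ⁿ
        ident₂ : ∀ P c t w → 2 ℕ.* P ℕ.+ 2 ℕ.* (P ℕ.* c ℕ.+ t ℕ.* w) ≡
                 2 ℕ.* P ℕ.* (1 ℕ.+ c) ℕ.+ 2 ℕ.* t ℕ.* w
        ident₂ = solve-∀ⁿ

  -- A set `S` not contained in `J` has some element outside `J`, and that element pays for `w`;
  -- further such elements only enlarge the right side.
  cost : ∀ {D} (J S : Vec Bool D) c w → 0ℤ ≤ w →
    c * + card S + ι (not (inside J S)) * w ≤
    ∑F D (λ e → ι (lookup S e) * (c + ι (not (lookup J e)) * w))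
  cost [] [] c w _ = ≤-reflexive (ident c w)
    where abstract ident : ∀ c w → c * 0ℤ + 0ℤ * w ≡ 0ℤ
                   ident = solve-∀
  cost (j ∷ J) (false ∷ S) c w 0≤w = ≤-trans (cost J S c w 0≤w)
    (≤-reflexive (ident (c + ι (not (lookup (j ∷ J) zero)) * w)
      (∑F _ (λ e → ι (lookup S e) * (c + ι (not (lookup J e)) * w)))))
    where abstract ident : ∀ a r → r ≡ 0ℤ * a + r
                   ident = solve-∀
  cost (true ∷ J) (true ∷ S) c w 0≤w = ≤-trans (≤-reflexive (trans
      (cong (λ z → c * z + ι (not (inside J S)) * w) (pos-+ 1 (card S)))
      (ident c w (+ card S) (ι (not (inside J S)) * w))))
    (+-monoʳ-≤ (1ℤ * (c + 0ℤ * w)) (cost J S c w 0≤w))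
    where abstract ident : ∀ c w k r → c * (1ℤ + k) + r ≡ 1ℤ * (c + 0ℤ * w) + (c * k + r)
                   ident = solve-∀
  cost (false ∷ J) (true ∷ S) c w 0≤w = ≤-trans
    (≤-by (ι (not (inside J S)) * w) (0≤-* (0≤+ ⟦ not (inside J S) ⟧) 0≤w) (trans
      (cong (λ z → c * z + 1ℤ * w + ι (not (inside J S)) * w) (pos-+ 1 (card S)))
      (ident c w (+ card S) (ι (not (inside J S)) * w))))
    (+-monoʳ-≤ (1ℤ * (c + 1ℤ * w)) (cost J S c w 0≤w))
    where abstract ident : ∀ c w k r → c * (1ℤ + k) + 1ℤ * w + r ≡ 1ℤ * (c + 1ℤ * w) + (c * k + r)
                   ident = solve-∀

  -- The split into high and low levels, done for each `S` at once. By `level`, `suc d` is at most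
  -- |S| plus `2 ^ (d - |S|)`. The first summand is what total influence measures at `S`, the second
  -- what the noise forms of derivatives measure, and `cost` charges the latter only to directions
  -- outside `J`.
  weights : ∀ {D} d (J S : Vec Bool D) →
    (pw 2 D * + suc d) * ι (not (inside J S)) ≤
    ∑F D (λ e → ι (lookup S e) * (pw 2 D + ι (not (lookup J e)) * (pw 2 d * + wt S)))
  weights {D} d J S = ≤-trans (outside (not (inside J S)))
    (cost J S (pw 2 D) (pw 2 d * + wt S) 0≤w)
    where
      0≤w : 0ℤ ≤ pw 2 d * + wt S
      0≤w = 0≤-* (0≤+ (2 ℕ.^ d)) (0≤+ (wt S))
      level' : pw 2 D * + suc d ≤ pw 2 D * + card S + pw 2 d * + wt S
      level' = subst₂ _≤_ (pos-* (2 ℕ.^ D) (suc d))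
        (trans (pos-+ (2 ℕ.^ D ℕ.* card S) (2 ℕ.^ d ℕ.* wt S))
          (cong₂ _+_ (pos-* (2 ℕ.^ D) (card S)) (pos-* (2 ℕ.^ d) (wt S))))
        (+≤+ (level d S))
      outside : ∀ b → (pw 2 D * + suc d) * ι b ≤ pw 2 D * + card S + ι b * (pw 2 d * + wt S)
      outside true = subst₂ _≤_ (sym (*-identityʳ (pw 2 D * + suc d)))
        (cong (λ z → pw 2 D * + card S + z) (sym (*-identityˡ (pw 2 d * + wt S)))) level'
      outside false = subst₂ _≤_ (sym (*-zeroʳ (pw 2 D * + suc d)))
        (trans (sym (+-identityʳ (pw 2 D * + card S)))
          (cong (λ z → pw 2 D * + card S + z) (sym (*-zeroˡ (pw 2 d * + wt S)))))
        (0≤-* (0≤+ (2 ℕ.^ D)) (0≤+ (card S)))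

  -- Multiply `weights` by `4 * hat²` and sum over `S`. Exchanging the sums leaves, for each
  -- direction, a Parseval sum and, if the direction is outside `J`, a noise form controlled by
  -- small-set expansion.
  junta-ℤ : ∀ D d (J : Vec Bool D) (f : Fn D) → (∀ e x → Sign (∂ e f x)) →
    (∀ e → lookup J e ≡ false → pw 16 d * energy D (∂ e f) ≤ pw 2 D) →
    + suc d * dis D J f ≤ pw 2 D * ∑F D (λ e → energy D (∂ e f))
  junta-ℤ D d J f sign small = cancel (2 ℕ.^ D) (cancel 2 (begin
    + 2 * (P * (+ suc d * dis D J f))
      ≡⟨ cong (λ z → + 2 * (P * (+ suc d * z))) (dis-spectrum D J f) ⟩
    + 2 * (P * (+ suc d * (+ 2 * ∑ D (λ S → ι (not (inside J S)) * (hat D f S * hat D f S)))))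
      ≡⟨ regroup P (+ suc d) (∑ D (λ S → ι (not (inside J S)) * (hat D f S * hat D f S))) ⟩
    (+ 4 * (P * + suc d)) * ∑ D (λ S → ι (not (inside J S)) * (hat D f S * hat D f S))
      ≡⟨ ∑-* D (+ 4 * (P * + suc d)) (λ S → ι (not (inside J S)) * (hat D f S * hat D f S)) ⟨
    ∑ D (λ S → (+ 4 * (P * + suc d)) * (ι (not (inside J S)) * (hat D f S * hat D f S)))
      ≤⟨ ∑-mono D perS ⟩
    ∑ D (λ S → ∑F D (λ e → G e S))
      ≡⟨ ∑-∑F D D G ⟩
    ∑F D (λ e → ∑ D (G e))
      ≤⟨ ∑F-mono D perE ⟩
    ∑F D (λ e → (+ 2 * (P * P)) * energy D (∂ e f))
      ≡⟨ ∑F-* D (+ 2 * (P * P)) (λ e → energy D (∂ e f)) ⟩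
    (+ 2 * (P * P)) * ∑F D (λ e → energy D (∂ e f))
      ≡⟨ assoc P (∑F D (λ e → energy D (∂ e f))) ⟩
    + 2 * (P * (P * ∑F D (λ e → energy D (∂ e f)))) ∎))
    where
      open ≤-Reasoning
      P = pw 2 D
      τ = pw 2 d
      instance
        2^D≢0 : ℕ.NonZero (2 ℕ.^ D)
        2^D≢0 = ℕ.m^n≢0 2 D
      abstract
        regroup : ∀ p s a → + 2 * (p * (s * (+ 2 * a))) ≡ (+ 4 * (p * s)) * a
        regroup = solve-∀
        assoc : ∀ p a → (+ 2 * (p * p)) * a ≡ + 2 * (p * (p * a))
        assoc = solve-∀
      H : Fin D → Fn D
      H e S = hat D (∂ e f) S * hat D (∂ e f) S
      G : Fin D → Fn D
      G e S = P * H e S + (ι (not (lookup J e)) * τ) * (+ wt S * H e S)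
      perS : ∀ S → (+ 4 * (P * + suc d)) * (ι (not (inside J S)) * (hat D f S * hat D f S)) ≤
                   ∑F D (λ e → G e S)
      perS S = begin
        (+ 4 * (P * + suc d)) * (ι (not (inside J S)) * h²)
          ≡⟨ ident₁ (P * + suc d) (ι (not (inside J S))) h² ⟩
        (+ 4 * h²) * ((P * + suc d) * ι (not (inside J S)))
          ≤⟨ *-monoˡ (+ 4 * h²) (0≤-* (0≤+ 4) (0≤sq (hat D f S))) (weights d J S) ⟩
        (+ 4 * h²) * ∑F D (λ e → ι (lookup S e) * (P + ι (not (lookup J e)) * (τ * + wt S)))
          ≡⟨ ∑F-* D (+ 4 * h²) (λ e → ι (lookup S e) * (P + ι (not (lookup J e)) * (τ * + wt S))) ⟨
        ∑F D (λ e → (+ 4 * h²) * (ι (lookup S e) * (P + ι (not (lookup J e)) * (τ * + wt S))))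
          -- The 4 is the square of the 2 in `hat-∂`: for `e` in `S`, four times the squared
          -- coefficient of `f` is the squared coefficient of its derivative.
          ≡⟨ ∑F-cong D (λ e → perTerm (lookup S e) (ι (not (lookup J e))) (hat-∂ D e f S)) ⟩
        ∑F D (λ e → G e S) ∎
        where
          h² = hat D f S * hat D f S
          abstract
            ident₁ : ∀ a o h → (+ 4 * a) * (o * h) ≡ (+ 4 * h) * (a * o)
            ident₁ = solve-∀
            on : ∀ h p j t w → (+ 4 * (h * h)) * (1ℤ * (p + j * (t * w))) ≡
                 p * (((+ 2 * 1ℤ) * h) * ((+ 2 * 1ℤ) * h)) + (j * t) * (w * (((+ 2 * 1ℤ) * h) * ((+ 2 * 1ℤ) * h)))
            on = solve-∀
            off : ∀ h p j t w → (+ 4 * (h * h)) * (0ℤ * (p + j * (t * w))) ≡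
                 p * (((+ 2 * 0ℤ) * h) * ((+ 2 * 0ℤ) * h)) + (j * t) * (w * (((+ 2 * 0ℤ) * h) * ((+ 2 * 0ℤ) * h)))
            off = solve-∀
          perTerm : ∀ s j {u} → u ≡ (+ 2 * ι s) * hat D f S →
            (+ 4 * h²) * (ι s * (P + j * (τ * + wt S))) ≡ P * (u * u) + (j * τ) * (+ wt S * (u * u))
          perTerm true j refl = on (hat D f S) P j τ (+ wt S)
          perTerm false j refl = off (hat D f S) P j τ (+ wt S)
      perE : ∀ e → ∑ D (G e) ≤ (+ 2 * (P * P)) * energy D (∂ e f)
      perE e = begin
        ∑ D (G e)
          ≡⟨ ∑-lin₂ D P (ι (not (lookup J e)) * τ) (H e) (λ S → + wt S * H e S) ⟩
        P * ∑ D (H e) + (ι (not (lookup J e)) * τ) * ∑ D (λ S → + wt S * H e S)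
          ≡⟨ cong₂ (λ a b → P * a + (ι (not (lookup J e)) * τ) * b)
               (parseval D (∂ e f)) (sym (noise-form D (∂ e f))) ⟩
        P * (P * E) + (ι (not (lookup J e)) * τ) * W
          -- The noise term costs no more than the Parseval term: outside `J` by small-set
          -- expansion, inside `J` because its coefficient is 0.
          ≤⟨ +-monoʳ-≤ (P * (P * E)) (outside (lookup J e) refl) ⟩
        P * (P * E) + (P * P) * E
          ≡⟨ collect P E ⟩
        (+ 2 * (P * P)) * E ∎
        where
          E = energy D (∂ e f)
          W = ∑ D (λ x → ∂ e f x * K D (∂ e f) x)
          abstract
            collect : ∀ p s → p * (p * s) + (p * p) * s ≡ (+ 2 * (p * p)) * s
            collect = solve-∀
            one : ∀ t w → (1ℤ * t) * w ≡ t * w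
            one = solve-∀
            none : ∀ t w → (0ℤ * t) * w ≡ 0ℤ
            none = solve-∀
          outside : ∀ b → lookup J e ≡ b → (ι (not b) * τ) * W ≤ (P * P) * E
          outside true _ = ≤-trans (≤-reflexive (none τ W))
            (0≤-* (0≤-* (0≤+ (2 ℕ.^ D)) (0≤+ (2 ℕ.^ D))) (0≤energy D (∂ e f)))
          outside false e∉J = ≤-trans (≤-reflexive (one τ W))
            (≤-trans (small-set-expansion D d (∂ e f) (sign e) (small e e∉J))
              (≤-reflexive (cong (_* E) (sym (pw-* 2 2 D)))))

  -- Return to Boolean functions and natural numbers

  ∑-cast : ∀ D {f : Fn D} {g : Vec Bool D → ℕ} → (∀ x → f x ≡ + g x) → ∑ D f ≡ + vsum bsum D g
  ∑-cast zero p = p []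
  ∑-cast (suc D) {g = g} p = trans
    (cong₂ _+_ (∑-cast D {g = λ x → g (false ∷ x)} (λ x → p (false ∷ x)))
               (∑-cast D {g = λ x → g (true ∷ x)} (λ x → p (true ∷ x))))
    (sym (pos-+ (vsum bsum D (λ x → g (false ∷ x))) (vsum bsum D (λ x → g (true ∷ x)))))

  ∑F-cast : ∀ n {f : Fin n → ℤ} {g : Fin n → ℕ} → (∀ x → f x ≡ + g x) → ∑F n f ≡ + fsum n g
  ∑F-cast zero p = refl
  ∑F-cast (suc n) {g = g} p = trans (cong₂ _+_ (p zero) (∑F-cast n {g = λ i → g (suc i)} (λ i → p (suc i))))
    (sym (pos-+ (g zero) (fsum n (λ i → g (suc i)))))

  square-difference : ∀ a b → (ι a - ι b) * (ι a - ι b) ≡ + ⟦ a xor b ⟧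
  square-difference true true = refl
  square-difference true false = refl
  square-difference false true = refl
  square-difference false false = refl

  sign-difference : ∀ a b → Sign (ι a - ι b)
  sign-difference true true = zero
  sign-difference true false = plus
  sign-difference false true = minus
  sign-difference false false = zero

  -- For values 0 and 1 a squared difference is an exclusive or, so the energy of a derivative is an
  -- influence and `dis` counts disagreeing pairs.
  junta-cube : ∀ D d (J : Vec Bool D) (f : Vec Bool D → Bool) →
    (∀ e → lookup J e ≡ false → 16 ℕ.^ d ℕ.* infl D f e ℕ.≤ 2 ℕ.^ D) →
    suc d ℕ.* mixDis bsum D J f ℕ.≤ 2 ℕ.^ D ℕ.* fsum D (infl D f)
  junta-cube D d J f small = drop‿+≤+ (subst₂ _≤_
    (trans (cong (+ suc d *_) mix≡) (sym (pos-* (suc d) (mixDis bsum D J f))))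
    (trans (cong (pw 2 D *_) (∑F-cast D infl≡)) (sym (pos-* (2 ℕ.^ D) (fsum D (infl D f)))))
    (junta-ℤ D d J (λ x → ι (f x)) (λ e x → sign-difference (f x) (f (updateAt x e not)))
      (λ e e∉J → subst (_≤ pw 2 D)
        (trans (pos-* (16 ℕ.^ d) (infl D f e)) (cong (pw 16 d *_) (sym (infl≡ e)))) (+≤+ (small e e∉J)))))
    where
      infl≡ : ∀ e → energy D (∂ e (λ x → ι (f x))) ≡ + infl D f e
      infl≡ e = ∑-cast D (λ x → square-difference (f x) (f (updateAt x e not)))
      mix≡ : dis D J (λ x → ι (f x)) ≡ + mixDis bsum D J f
      mix≡ = ∑-cast D (λ x → ∑-cast D (λ z → square-difference (f x) (f (mix J x z))))

open Fourier using (junta-cube)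

open import Data.Nat using (_+_; _*_; _^_; _∸_; _≤_; _<_; z≤n; s≤s; ∣_-_∣; _≡ᵇ_; NonZero; >-nonZero; _/_; _%_; _≤?_)
open import Data.Nat.Properties hiding (_≟_)
open import Data.Nat.DivMod using (m≡m%n+[m/n]*n; m%n<n; m/n*n≤m; m*n/n≡m; /-monoˡ-≤)
open import Data.Nat.Tactic.RingSolver using (solve-∀)

-- Finite summation

-- One set of laws for sums over `Bool`, `Fin n` and vectors of either. `∑-swap` asks of the second
-- sum only additivity and the value 0 at 0, the latter for an empty first sum.
record Summation {X : Set} (σ : (X → ℕ) → ℕ) : Set₁ where
  field
    ∑-cong : ∀ {f g} → (∀ x → f x ≡ g x) → σ f ≡ σ g
    ∑-mono : ∀ {f g} → (∀ x → f x ≤ g x) → σ f ≤ σ g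
    ∑-+ : ∀ f g → σ (λ x → f x + g x) ≡ σ f + σ g
    ∑-* : ∀ c f → σ (λ x → c * f x) ≡ c * σ f
    term≤∑ : ∀ f x → f x ≤ σ f
    ∑-swap : ∀ {Y : Set} (τ : (Y → ℕ) → ℕ) →
      (∀ f g → τ (λ y → f y + g y) ≡ τ f + τ g) → τ (λ _ → 0) ≡ 0 →
      ∀ (F : X → Y → ℕ) → σ (λ x → τ (F x)) ≡ τ (λ y → σ (λ x → F x y))
  ∑-0 : σ (λ _ → 0) ≡ 0
  ∑-0 = ∑-* 0 (λ _ → 0)

open Summation public

swap-+ : ∀ a b c d → (a + b) + (c + d) ≡ (a + c) + (b + d)
swap-+ = solve-∀

bsum-summation : Summation bsum
bsum-summation .∑-cong p = cong₂ _+_ (p false) (p true)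
bsum-summation .∑-mono p = +-mono-≤ (p false) (p true)
bsum-summation .∑-+ f g = swap-+ (f false) (g false) (f true) (g true)
bsum-summation .∑-* c f = sym (*-distribˡ-+ c (f false) (f true))
bsum-summation .term≤∑ f false = m≤m+n (f false) (f true)
bsum-summation .term≤∑ f true = m≤n+m (f true) (f false)
bsum-summation .∑-swap τ τ-+ _ F = sym (τ-+ (F false) (F true))

fsum-summation : ∀ n → Summation (fsum n)
fsum-summation zero .∑-cong p = refl
fsum-summation (suc n) .∑-cong p = cong₂ _+_ (p zero) (fsum-summation n .∑-cong (λ i → p (suc i)))
fsum-summation zero .∑-mono p = z≤n
fsum-summation (suc n) .∑-mono p = +-mono-≤ (p zero) (fsum-summation n .∑-mono (λ i → p (suc i)))
fsum-summation zero .∑-+ f g = refl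
fsum-summation (suc n) .∑-+ f g = trans
  (cong (f zero + g zero +_) (fsum-summation n .∑-+ (λ i → f (suc i)) (λ i → g (suc i))))
  (swap-+ (f zero) (g zero) _ _)
fsum-summation zero .∑-* c f = sym (*-zeroʳ c)
fsum-summation (suc n) .∑-* c f = trans
  (cong (c * f zero +_) (fsum-summation n .∑-* c (λ i → f (suc i))))
  (sym (*-distribˡ-+ c (f zero) _))
fsum-summation (suc n) .term≤∑ f zero = m≤m+n (f zero) _
fsum-summation (suc n) .term≤∑ f (suc i) =
  ≤-trans (fsum-summation n .term≤∑ (λ i → f (suc i)) i) (m≤n+m _ (f zero))
fsum-summation zero .∑-swap τ _ τ-0 F = sym τ-0
fsum-summation (suc n) .∑-swap τ τ-+ τ-0 F = trans
  (cong (τ (F zero) +_) (fsum-summation n .∑-swap τ τ-+ τ-0 (λ i → F (suc i))))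
  (sym (τ-+ (F zero) _))

module _ {X : Set} {σ : (X → ℕ) → ℕ} (S : Summation σ) where

  vsum-summation : ∀ n → Summation (vsum σ n)
  vsum-summation zero .∑-cong p = p []
  vsum-summation (suc n) .∑-cong p = S .∑-cong (λ x → vsum-summation n .∑-cong (λ xs → p (x ∷ xs)))
  vsum-summation zero .∑-mono p = p []
  vsum-summation (suc n) .∑-mono p = S .∑-mono (λ x → vsum-summation n .∑-mono (λ xs → p (x ∷ xs)))
  vsum-summation zero .∑-+ f g = refl
  vsum-summation (suc n) .∑-+ f g = trans
    (S .∑-cong (λ x → vsum-summation n .∑-+ (λ xs → f (x ∷ xs)) (λ xs → g (x ∷ xs)))) (S .∑-+ _ _)
  vsum-summation zero .∑-* c f = refl
  vsum-summation (suc n) .∑-* c f = trans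
    (S .∑-cong (λ x → vsum-summation n .∑-* c (λ xs → f (x ∷ xs)))) (S .∑-* c _)
  vsum-summation zero .term≤∑ f [] = ≤-refl
  vsum-summation (suc n) .term≤∑ f (x ∷ xs) = ≤-trans
    (vsum-summation n .term≤∑ (λ xs → f (x ∷ xs)) xs) (S .term≤∑ (λ x → vsum σ n (λ xs → f (x ∷ xs))) x)
  vsum-summation zero .∑-swap _ _ _ F = refl
  vsum-summation (suc n) .∑-swap τ τ-+ τ-0 F = trans
    (S .∑-cong (λ x → vsum-summation n .∑-swap τ τ-+ τ-0 (λ xs → F (x ∷ xs)))) (S .∑-swap τ τ-+ τ-0 _)

cube : ∀ D → Summation (vsum bsum D)
cube = vsum-summation bsum-summation

cube-const : ∀ D c → vsum bsum D (λ _ → c) ≡ 2 ^ D * c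
cube-const zero c = sym (*-identityˡ c)
cube-const (suc D) c = trans (cong₂ _+_ (cube-const D c) (cube-const D c)) (ident (2 ^ D) c)
  where abstract ident : ∀ p c → p * c + p * c ≡ 2 * p * c
                 ident = solve-∀

-- Jumps and sums of sequences

-- The total variation, with `t` counting steps and not terms. The value at `t` is included, so in
-- `tv-+` the jump at the seam belongs to the first part.
tv : (ℕ → Bool) → ℕ → ℕ
tv H zero = 0
tv H (suc t) = ⟦ H 0 xor H 1 ⟧ + tv (λ s → H (suc s)) t

tv-+ : ∀ H a b → tv H (a + b) ≡ tv H a + tv (λ s → H (a + s)) b
tv-+ H zero b = refl
tv-+ H (suc a) b = trans (cong (⟦ H 0 xor H 1 ⟧ +_) (tv-+ (λ s → H (suc s)) a b))
  (sym (+-assoc ⟦ H 0 xor H 1 ⟧ _ _))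

tv-mono : ∀ H {s t} → s ≤ t → tv H s ≤ tv H t
tv-mono H z≤n = z≤n
tv-mono H (s≤s p) = +-monoʳ-≤ ⟦ H 0 xor H 1 ⟧ (tv-mono (λ s → H (suc s)) p)

xor-triangle : ∀ a b c → ⟦ a xor c ⟧ ≤ ⟦ a xor b ⟧ + ⟦ b xor c ⟧
xor-triangle true true c = ≤-refl
xor-triangle true false true = z≤n
xor-triangle true false false = s≤s z≤n
xor-triangle false true true = s≤s z≤n
xor-triangle false true false = z≤n
xor-triangle false false c = ≤-refl

xor-self : ∀ a → ⟦ a xor a ⟧ ≡ 0
xor-self true = refl
xor-self false = refl

jump≤tv : ∀ H t → ⟦ H 0 xor H t ⟧ ≤ tv H t
jump≤tv H zero = ≤-reflexive (xor-self (H 0))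
jump≤tv H (suc t) = ≤-trans (xor-triangle (H 0) (H 1) (H (suc t)))
  (+-monoʳ-≤ ⟦ H 0 xor H 1 ⟧ (jump≤tv (λ s → H (suc s)) t))

jump≤tv-+ : ∀ H a b → ⟦ H a xor H (a + b) ⟧ ≤ tv H (a + b)
jump≤tv-+ H a b = ≤-trans
  (subst (λ z → ⟦ H z xor H (a + b) ⟧ ≤ tv (λ s → H (a + s)) b) (+-identityʳ a) (jump≤tv (λ s → H (a + s)) b))
  (≤-trans (m≤n+m _ (tv H a)) (≤-reflexive (sym (tv-+ H a b))))

sumN : ℕ → (ℕ → ℕ) → ℕ
sumN zero F = 0
sumN (suc t) F = F 0 + sumN t (λ s → F (suc s))

sumN-+ : ∀ a b F → sumN (a + b) F ≡ sumN a F + sumN b (λ s → F (a + s))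
sumN-+ zero b F = refl
sumN-+ (suc a) b F = trans (cong (F 0 +_) (sumN-+ a b (λ s → F (suc s)))) (sym (+-assoc (F 0) _ _))

-- The head is the leading bit: fixing it leaves an interval of `2 ^ m` consecutive numbers, on
-- which induction over `m` can act.
num : ∀ {m} → Vec Bool m → ℕ
num [] = 0
num {suc m} (b ∷ x) = (if b then 2 ^ m else 0) + num x

num≤ : ∀ {m} (x : Vec Bool m) → num x ≤ 2 ^ m
num≤ [] = z≤n
num≤ {suc m} (false ∷ x) = ≤-trans (num≤ x) (m≤m+n (2 ^ m) _)
num≤ {suc m} (true ∷ x) = +-monoʳ-≤ (2 ^ m) (≤-trans (num≤ x) (m≤m+n (2 ^ m) 0))

cube-num : ∀ m F → vsum bsum m (λ x → F (num x)) ≡ sumN (2 ^ m) F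
cube-num zero F = sym (+-identityʳ (F 0))
cube-num (suc m) F = trans (cong₂ _+_ (cube-num m F) (cube-num m (λ s → F (2 ^ m + s))))
  (trans (sym (sumN-+ (2 ^ m) (2 ^ m) F)) (cong (λ t → sumN (2 ^ m + t) F) (sym (+-identityʳ (2 ^ m)))))

-- Doubling the length of a sequence adds one bit, whose influence is at most
-- its full measure and vanishes unless the sequence jumps; so the total
-- influence is controlled by the number of jumps independently of m.
dyadic-influence : ∀ m H → fsum m (infl m (λ x → H (num x))) ≤ 2 * (2 ^ m * tv H (2 ^ m))
dyadic-influence zero H = z≤n
dyadic-influence (suc m) H = begin
  (vsum bsum m (λ x → ⟦ f₀ x xor f₁ x ⟧) + vsum bsum m (λ x → ⟦ f₁ x xor f₀ x ⟧))
  + fsum m (λ e → infl m f₀ e + infl m f₁ e)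
    -- Relative to the size of the cube the leading bit contributes at most `V`. The next
    -- contributes at most `V / 2`, because the two halves share the jumps, and so on: the factor 2
    -- is a geometric series.
    ≤⟨ +-mono-≤ (+-mono-≤ (count≤ jump)
                          (count≤ λ x →
           subst (_≤ V) (xor-sym (f₀ x) (f₁ x)) (jump x)))
         (≤-reflexive (fsum-summation m .∑-+ (infl m f₀) (infl m f₁))) ⟩
  (N * V + N * V) + (fsum m (infl m f₀) + fsum m (infl m f₁))
    ≤⟨ +-monoʳ-≤ (N * V + N * V) (+-mono-≤ (dyadic-influence m H) (dyadic-influence m (λ s → H (N + s)))) ⟩
  (N * V + N * V) + (2 * (N * tv H N) + 2 * (N * tv (λ s → H (N + s)) N))
    ≡⟨ ident N V (tv H N) (tv (λ s → H (N + s)) N) ⟩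
  2 * (N * (V + (tv H N + tv (λ s → H (N + s)) N)))
    ≡⟨ cong (λ z → 2 * (N * (V + z))) (trans (sym (tv-+ H N N)) (cong (λ t → tv H (N + t)) (sym (+-identityʳ N)))) ⟩
  2 * (N * (V + V))
    ≡⟨ ident₂ N V ⟩
  2 * (2 * N * V) ∎
  where
    open ≤-Reasoning
    N = 2 ^ m
    V = tv H (2 ^ suc m)
    f₀ f₁ : Vec Bool m → Bool
    f₀ x = H (num x)
    f₁ x = H (N + num x)
    abstract
      ident : ∀ N V a b → (N * V + N * V) + (2 * (N * a) + 2 * (N * b)) ≡ 2 * (N * (V + (a + b)))
      ident = solve-∀
      ident₂ : ∀ N V → 2 * (N * (V + V)) ≡ 2 * (2 * N * V)
      ident₂ = solve-∀
    xor-sym : ∀ a b → ⟦ a xor b ⟧ ≡ ⟦ b xor a ⟧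
    xor-sym true true = refl
    xor-sym true false = refl
    xor-sym false true = refl
    xor-sym false false = refl
    jump : ∀ x → ⟦ f₀ x xor f₁ x ⟧ ≤ V
    jump x = subst (λ z → ⟦ f₀ x xor H z ⟧ ≤ V) (+-comm (num x) N) (≤-trans (jump≤tv-+ H (num x) N)
      (tv-mono H (≤-trans (+-monoˡ-≤ N (num≤ x)) (+-monoʳ-≤ N (m≤m+n N 0)))))
    count≤ : ∀ {g : Vec Bool m → ℕ} → (∀ x → g x ≤ V) → vsum bsum m g ≤ N * V
    count≤ p = ≤-trans (cube m .∑-mono p) (≤-reflexive (cube-const m V))

-- bl q c takes each value suc q times, except that 0 is taken suc c times.
bl : ℕ → ℕ → ℕ → ℕ
bl q c zero = 0
bl q (suc c) (suc t) = bl q c t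
bl q zero (suc t) = suc (bl q q t)

-- Repeating a value creates no jump, and `t` steps of the slowed sequence traverse at most `t`
-- steps of `H`.
tv-bl : ∀ q c (H : ℕ → Bool) t → tv (λ s → H (bl q c s)) t ≤ tv H t
tv-bl q c H zero = z≤n
tv-bl q (suc c) H (suc t) = ≤-trans
  (+-mono-≤ (≤-reflexive (xor-self (H 0))) (tv-bl q c H t)) (tv-mono H (n≤1+n t))
tv-bl q zero H (suc t) = +-monoʳ-≤ ⟦ H 0 xor H 1 ⟧ (tv-bl q q (λ s → H (suc s)) t)

sumN-bl : ∀ q c t (F : ℕ → ℕ) →
  sumN (suc c + t) (λ s → F (bl q c s)) ≡ suc c * F 0 + sumN t (λ s → F (suc (bl q q s)))
sumN-bl q zero t F = cong (_+ sumN t (λ s → F (suc (bl q q s)))) (sym (+-identityʳ (F 0)))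
sumN-bl q (suc c) t F = trans (cong (F 0 +_) (sumN-bl q c t F)) (sym (+-assoc (F 0) (suc c * F 0) _))

-- Truncation at `k`. It sends the surplus of `2 ^ m` over a multiple of the number of values into
-- the last fibre.
cap : ∀ k → ℕ → Fin (suc k)
cap zero t = zero
cap (suc k) zero = zero
cap (suc k) (suc t) = suc (cap k t)

cap-0 : ∀ k → cap k 0 ≡ zero
cap-0 zero = refl
cap-0 (suc k) = refl

lineBoundary : ∀ k → (Fin k → Bool) → ℕ
lineBoundary k a = fsum k (λ i → fsum k (λ j → ⟦ a i ∧ not (a j) ∧ (∣ toℕ i - toℕ j ∣ ≡ᵇ 1) ⟧))

lineBoundary-suc : ∀ k (a : Fin (suc (suc k)) → Bool) →
  ⟦ a zero xor a (suc zero) ⟧ + lineBoundary (suc k) (λ i → a (suc i)) ≤ lineBoundary (suc (suc k)) a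
lineBoundary-suc k a = begin
  ⟦ a zero xor a (suc zero) ⟧ + B                    ≤⟨ +-monoˡ-≤ B (first (a zero) (a (suc zero))) ⟩
  (E zero (suc zero) + E (suc zero) zero) + B        ≡⟨ +-assoc (E zero (suc zero)) _ B ⟩
  E zero (suc zero) + (E (suc zero) zero + B)
    ≤⟨ +-mono-≤ (term≤∑ (fsum-summation (suc (suc k))) (E zero) (suc zero))
         (+-monoˡ-≤ B (term≤∑ (fsum-summation (suc k)) (λ i → E (suc i) zero) zero)) ⟩
  fsum (suc (suc k)) (E zero) + (fsum (suc k) (λ i → E (suc i) zero) + B)
    ≡⟨ cong (fsum (suc (suc k)) (E zero) +_)
         (fsum-summation (suc k) .∑-+ (λ i → E (suc i) zero) (λ i → fsum (suc k) (λ j → E (suc i) (suc j)))) ⟨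
  lineBoundary (suc (suc k)) a ∎
  where
    open ≤-Reasoning
    B = lineBoundary (suc k) (λ i → a (suc i))
    E : Fin (suc (suc k)) → Fin (suc (suc k)) → ℕ
    E i j = ⟦ a i ∧ not (a j) ∧ (∣ toℕ i - toℕ j ∣ ≡ᵇ 1) ⟧
    first : ∀ x y → ⟦ x xor y ⟧ ≤ ⟦ x ∧ not y ∧ true ⟧ + ⟦ y ∧ not x ∧ true ⟧
    first true true = z≤n
    first true false = s≤s z≤n
    first false true = s≤s z≤n
    first false false = z≤n

-- Each jump is an edge leaving `a` in one of its two orientations. Past `k` the sequence is
-- constant, so the bound holds at every length.
tv-cap : ∀ k (a : Fin (suc k) → Bool) t → tv (λ s → a (cap k s)) t ≤ lineBoundary (suc k) a
tv-cap k a zero = z≤n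
tv-cap zero a (suc t) = +-mono-≤ (≤-reflexive (xor-self (a zero))) (tv-cap zero a t)
tv-cap (suc k) a (suc t) = ≤-trans
  (+-mono-≤ (≤-reflexive (cong (λ z → ⟦ a zero xor a (suc z) ⟧) (cap-0 k))) (tv-cap k (λ i → a (suc i)) t))
  (lineBoundary-suc k a)

sumN-const : ∀ t c → sumN t (λ _ → c) ≡ t * c
sumN-const zero c = refl
sumN-const (suc t) c = cong (c +_) (sumN-const t c)

sumN-blow-up-lower : ∀ k q r (F : Fin (suc k) → ℕ) →
  suc q * fsum (suc k) F ≤ sumN (suc k * suc q + r) (λ s → F (cap k (bl q q s)))
sumN-blow-up-lower zero q r F = ≤-trans
  (≤-trans (≤-reflexive (cong (suc q *_) (+-identityʳ (F zero))))
    (*-monoˡ-≤ (F zero) (≤-trans (≤-reflexive (sym (+-identityʳ (suc q)))) (m≤m+n (suc q + 0) r))))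
  (≤-reflexive (sym (sumN-const (1 * suc q + r) (F zero))))
sumN-blow-up-lower (suc k) q r F = begin
  suc q * (F zero + fsum (suc k) (λ i → F (suc i)))
    ≡⟨ *-distribˡ-+ (suc q) (F zero) _ ⟩
  suc q * F zero + suc q * fsum (suc k) (λ i → F (suc i))
    ≤⟨ +-monoʳ-≤ (suc q * F zero) (sumN-blow-up-lower k q r (λ i → F (suc i))) ⟩
  suc q * F zero + sumN (suc k * suc q + r) (λ s → F (suc (cap k (bl q q s))))
    ≡⟨ sumN-bl q q (suc k * suc q + r) (λ t → F (cap (suc k) t)) ⟨
  sumN (suc q + (suc k * suc q + r)) (λ s → F (cap (suc k) (bl q q s)))
    ≡⟨ cong (λ t → sumN t (λ s → F (cap (suc k) (bl q q s)))) (sym (+-assoc (suc q) (suc k * suc q) r)) ⟩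
  sumN (suc (suc k) * suc q + r) (λ s → F (cap (suc k) (bl q q s))) ∎
  where open ≤-Reasoning

sumN-blow-up-upper : ∀ k q r (F : Fin (suc k) → ℕ) →
  sumN (suc k * suc q + r) (λ s → F (cap k (bl q q s))) ≤ (suc q + r) * fsum (suc k) F
sumN-blow-up-upper zero q r F = ≤-reflexive (trans (sumN-const (1 * suc q + r) (F zero))
  (cong₂ (λ t c → (t + r) * c) (+-identityʳ (suc q)) (sym (+-identityʳ (F zero)))))
sumN-blow-up-upper (suc k) q r F = begin
  sumN (suc (suc k) * suc q + r) (λ s → F (cap (suc k) (bl q q s)))
    ≡⟨ cong (λ t → sumN t (λ s → F (cap (suc k) (bl q q s)))) (+-assoc (suc q) (suc k * suc q) r) ⟩
  sumN (suc q + (suc k * suc q + r)) (λ s → F (cap (suc k) (bl q q s)))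
    ≡⟨ sumN-bl q q (suc k * suc q + r) (λ t → F (cap (suc k) t)) ⟩
  suc q * F zero + sumN (suc k * suc q + r) (λ s → F (suc (cap k (bl q q s))))
    ≤⟨ +-mono-≤ (*-monoˡ-≤ (F zero) (m≤m+n (suc q) r)) (sumN-blow-up-upper k q r (λ i → F (suc i))) ⟩
  (suc q + r) * F zero + (suc q + r) * fsum (suc k) (λ i → F (suc i))
    ≡⟨ *-distribˡ-+ (suc q + r) (F zero) _ ⟨
  (suc q + r) * fsum (suc (suc k)) F ∎
  where open ≤-Reasoning

-- ψ stands for a monotone map {0,…,2^m - 1} → [k]; L and U bound its fibre sizes.
record BlowUp (k m L U : ℕ) : Set where
  field
    ψ : Vec Bool m → Fin k
    lower : ∀ F → L * fsum k F ≤ vsum bsum m (λ x → F (ψ x))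
    upper : ∀ F → vsum bsum m (λ x → F (ψ x)) ≤ U * fsum k F
    line : ∀ a → fsum m (infl m (λ x → a (ψ x))) ≤ 2 * (2 ^ m * lineBoundary k a)

blowUp : ∀ k m q r → 2 ^ m ≡ suc k * suc q + r → BlowUp (suc k) m (suc q) (suc q + r)
blowUp k m q r eq = record
  { ψ = λ x → φ (num x)
  ; lower = λ F → ≤-trans (sumN-blow-up-lower k q r F) (≤-reflexive (sym (total F)))
  ; upper = λ F → ≤-trans (≤-reflexive (total F)) (sumN-blow-up-upper k q r F)
  ; line = λ a → ≤-trans (dyadic-influence m (λ s → a (φ s))) (*-monoʳ-≤ 2 (*-monoʳ-≤ (2 ^ m)
      (≤-trans (tv-bl q q (λ s → a (cap k s)) (2 ^ m)) (tv-cap k a (2 ^ m)))))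
  }
  where
    φ : ℕ → Fin (suc k)
    φ s = cap k (bl q q s)
    total : ∀ F → vsum bsum m (λ x → F (φ (num x))) ≡ sumN (suc k * suc q + r) (λ s → F (φ s))
    total F = trans (cube-num m (λ s → F (φ s))) (cong (λ t → sumN t (λ s → F (φ s))) eq)

-- Blowing up the grid to a cube

fsum-split : ∀ m r (f : Fin (m + r) → ℕ) →
  fsum (m + r) f ≡ fsum m (λ i → f (i ↑ˡ r)) + fsum r (λ i → f (m ↑ʳ i))
fsum-split zero r f = refl
fsum-split (suc m) r f = trans (cong (f zero +_) (fsum-split m r (λ i → f (suc i))))
  (sym (+-assoc (f zero) _ _))

fsum-combine : ∀ n m (f : Fin (n * m) → ℕ) →
  fsum (n * m) f ≡ fsum n (λ i → fsum m (λ j → f (combine i j)))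
fsum-combine zero m f = refl
fsum-combine (suc n) m f = trans (fsum-split m (n * m) f)
  (cong (fsum m (λ j → f (j ↑ˡ (n * m))) +_) (fsum-combine n m (λ e → f (m ↑ʳ e))))

vsum-split : ∀ {X : Set} {σ : (X → ℕ) → ℕ} → Summation σ → ∀ m r (F : Vec X m → Vec X r → ℕ) →
  vsum σ (m + r) (λ x → F (take m x) (drop m x)) ≡ vsum σ m (λ x → vsum σ r (F x))
vsum-split S zero r F = refl
vsum-split S (suc m) r F = S .∑-cong (λ x → vsum-split S m r (λ xs → F (x ∷ xs)))

module _ {X : Set} where

  take-updateAt-↑ˡ : ∀ m r (x : Vec X (m + r)) j g → take m (updateAt x (j ↑ˡ r) g) ≡ updateAt (take m x) j g
  take-updateAt-↑ˡ (suc m) r (b ∷ x) zero g = refl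
  take-updateAt-↑ˡ (suc m) r (b ∷ x) (suc j) g = cong (b ∷_) (take-updateAt-↑ˡ m r x j g)

  drop-updateAt-↑ˡ : ∀ m r (x : Vec X (m + r)) j g → drop m (updateAt x (j ↑ˡ r) g) ≡ drop m x
  drop-updateAt-↑ˡ (suc m) r (b ∷ x) zero g = refl
  drop-updateAt-↑ˡ (suc m) r (b ∷ x) (suc j) g = drop-updateAt-↑ˡ m r x j g

  take-updateAt-↑ʳ : ∀ m r (x : Vec X (m + r)) e g → take m (updateAt x (m ↑ʳ e) g) ≡ take m x
  take-updateAt-↑ʳ zero r x e g = refl
  take-updateAt-↑ʳ (suc m) r (b ∷ x) e g = cong (b ∷_) (take-updateAt-↑ʳ m r x e g)

  drop-updateAt-↑ʳ : ∀ m r (x : Vec X (m + r)) e g → drop m (updateAt x (m ↑ʳ e) g) ≡ updateAt (drop m x) e g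
  drop-updateAt-↑ʳ zero r x e g = refl
  drop-updateAt-↑ʳ (suc m) r (b ∷ x) e g = drop-updateAt-↑ʳ m r x e g

  take-mix : ∀ m r b (J : Vec Bool r) (x z : Vec X (m + r)) →
    take m (mix (replicate m b ++ J) x z) ≡ (if b then take m x else take m z)
  take-mix zero r true J x z = refl
  take-mix zero r false J x z = refl
  take-mix (suc m) r true J (x ∷ xs) (z ∷ zs) = cong (x ∷_) (take-mix m r true J xs zs)
  take-mix (suc m) r false J (x ∷ xs) (z ∷ zs) = cong (z ∷_) (take-mix m r false J xs zs)

  drop-mix : ∀ m r b (J : Vec Bool r) (x z : Vec X (m + r)) →
    drop m (mix (replicate m b ++ J) x z) ≡ mix J (drop m x) (drop m z)
  drop-mix zero r b J x z = refl
  drop-mix (suc m) r b J (x ∷ xs) (z ∷ zs) = drop-mix m r b J xs zs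

infl-↑ˡ : ∀ m r (F : Vec Bool m → Vec Bool r → Bool) j →
  infl (m + r) (λ x → F (take m x) (drop m x)) (j ↑ˡ r) ≡ vsum bsum r (λ y → infl m (λ x → F x y) j)
infl-↑ˡ m r F j = trans
  (cube (m + r) .∑-cong (λ x → cong₂ (λ a b → ⟦ F (take m x) (drop m x) xor F a b ⟧)
    (take-updateAt-↑ˡ m r x j not) (drop-updateAt-↑ˡ m r x j not)))
  (trans (vsum-split bsum-summation m r (λ x y → ⟦ F x y xor F (updateAt x j not) y ⟧))
    (cube m .∑-swap (vsum bsum r) (cube r .∑-+) (∑-0 (cube r)) (λ x y → ⟦ F x y xor F (updateAt x j not) y ⟧)))

infl-↑ʳ : ∀ m r (F : Vec Bool m → Vec Bool r → Bool) e →
  infl (m + r) (λ x → F (take m x) (drop m x)) (m ↑ʳ e) ≡ vsum bsum m (λ x → infl r (F x) e)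
infl-↑ʳ m r F e = trans
  (cube (m + r) .∑-cong (λ x → cong₂ (λ a b → ⟦ F (take m x) (drop m x) xor F a b ⟧)
    (take-updateAt-↑ʳ m r x e not) (drop-updateAt-↑ʳ m r x e not)))
  (vsum-split bsum-summation m r (λ x y → ⟦ F x y xor F x (updateAt y e not) ⟧))

-- The bits of a block are kept or resampled together, so that mixing in the cube lies over mixing
-- in the grid.
spread : ∀ {n} m → Vec Bool n → Vec Bool (n * m)
spread m [] = []
spread m (j ∷ J) = replicate m j ++ spread m J

lookup-spread : ∀ {n} m (J : Vec Bool n) i j → lookup (spread m J) (combine i j) ≡ lookup J i
lookup-spread m (b ∷ J) zero j = trans (lookup-++ˡ (replicate m b) (spread m J) j) (lookup-replicate j b)
lookup-spread m (b ∷ J) (suc i) j = trans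
  (lookup-++ʳ (replicate m b) (spread m J) (combine i j)) (lookup-spread m J i j)

-- Boundary edges by direction, the counterpart in the grid of `infl`.
gridBoundary : ∀ {k} n → (Vec (Fin k) n → Bool) → Fin n → ℕ
gridBoundary {k} (suc n) A zero = vsum (fsum k) n (λ v → lineBoundary k (λ i → A (i ∷ v)))
gridBoundary {k} (suc n) A (suc e) = fsum k (λ i → gridBoundary n (λ v → A (i ∷ v)) e)

module Lift {k m L U} (β : BlowUp k m L U) where
  open BlowUp β

  lift : ∀ n → Vec Bool (n * m) → Vec (Fin k) n
  lift zero x = []
  lift (suc n) x = ψ (take m x) ∷ lift n (drop m x)

  lift-mix : ∀ n J (x z : Vec Bool (n * m)) → lift n (mix (spread m J) x z) ≡ mix J (lift n x) (lift n z)
  lift-mix zero [] x z = refl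
  lift-mix (suc n) (j ∷ J) x z = cong₂ _∷_
    (trans (cong ψ (take-mix m (n * m) j (spread m J) x z)) (choose j))
    (trans (cong (lift n) (drop-mix m (n * m) j (spread m J) x z)) (lift-mix n J (drop m x) (drop m z)))
    where choose : ∀ j → ψ (if j then take m x else take m z) ≡ (if j then ψ (take m x) else ψ (take m z))
          choose true = refl
          choose false = refl

  lift-lower : ∀ n F → L ^ n * vsum (fsum k) n F ≤ vsum bsum (n * m) (λ x → F (lift n x))
  lift-lower zero F = ≤-reflexive (*-identityˡ (F []))
  lift-lower (suc n) F = begin
    L * L ^ n * fsum k G
      ≡⟨ *-assoc L (L ^ n) (fsum k G) ⟩
    L * (L ^ n * fsum k G)
      ≡⟨ cong (L *_) (fsum-summation k .∑-* (L ^ n) G) ⟨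
    L * fsum k (λ i → L ^ n * G i)
      ≤⟨ lower (λ i → L ^ n * G i) ⟩
    vsum bsum m (λ x → L ^ n * G (ψ x))
      ≤⟨ cube m .∑-mono (λ x → lift-lower n (λ v → F (ψ x ∷ v))) ⟩
    vsum bsum m (λ x → vsum bsum (n * m) (λ y → F (ψ x ∷ lift n y)))
      ≡⟨ vsum-split bsum-summation m (n * m) (λ x y → F (ψ x ∷ lift n y)) ⟨
    vsum bsum (suc n * m) (λ x → F (lift (suc n) x)) ∎
    where
      open ≤-Reasoning
      G : Fin k → ℕ
      G i = vsum (fsum k) n (λ v → F (i ∷ v))

  lift-upper : ∀ n F → vsum bsum (n * m) (λ x → F (lift n x)) ≤ U ^ n * vsum (fsum k) n F
  lift-upper zero F = ≤-reflexive (sym (*-identityˡ (F [])))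
  lift-upper (suc n) F = begin
    vsum bsum (suc n * m) (λ x → F (lift (suc n) x))
      ≡⟨ vsum-split bsum-summation m (n * m) (λ x y → F (ψ x ∷ lift n y)) ⟩
    vsum bsum m (λ x → vsum bsum (n * m) (λ y → F (ψ x ∷ lift n y)))
      ≤⟨ cube m .∑-mono (λ x → lift-upper n (λ v → F (ψ x ∷ v))) ⟩
    vsum bsum m (λ x → U ^ n * G (ψ x))
      ≤⟨ upper (λ i → U ^ n * G i) ⟩
    U * fsum k (λ i → U ^ n * G i)
      ≡⟨ cong (U *_) (fsum-summation k .∑-* (U ^ n) G) ⟩
    U * (U ^ n * fsum k G)
      ≡⟨ *-assoc U (U ^ n) (fsum k G) ⟨
    U * U ^ n * fsum k G ∎
    where
      open ≤-Reasoning
      G : Fin k → ℕ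
      G i = vsum (fsum k) n (λ v → F (i ∷ v))

  mixDis-lift : ∀ n J A →
    L ^ n * (L ^ n * mixDis (fsum k) n J A) ≤ mixDis bsum (n * m) (spread m J) (λ x → A (lift n x))
  mixDis-lift n J A = begin
    L ^ n * (L ^ n * mixDis (fsum k) n J A)
      ≤⟨ *-monoʳ-≤ (L ^ n) (lift-lower n (λ v → vsum (fsum k) n (λ w → ⟦ A v xor A (mix J v w) ⟧))) ⟩
    L ^ n * vsum bsum (n * m) (λ x → vsum (fsum k) n (λ w → ⟦ A (lift n x) xor A (mix J (lift n x) w) ⟧))
      ≡⟨ cube (n * m) .∑-* (L ^ n) _ ⟨
    vsum bsum (n * m) (λ x → L ^ n * vsum (fsum k) n (λ w → ⟦ A (lift n x) xor A (mix J (lift n x) w) ⟧))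
      ≤⟨ cube (n * m) .∑-mono (λ x → lift-lower n (λ w → ⟦ A (lift n x) xor A (mix J (lift n x) w) ⟧)) ⟩
    vsum bsum (n * m) (λ x → vsum bsum (n * m) (λ z → ⟦ A (lift n x) xor A (mix J (lift n x) (lift n z)) ⟧))
      ≡⟨ cube (n * m) .∑-cong (λ x → cube (n * m) .∑-cong (λ z →
           cong (λ v → ⟦ A (lift n x) xor A v ⟧) (lift-mix n J x z))) ⟨
    mixDis bsum (n * m) (spread m J) (λ x → A (lift n x)) ∎
    where open ≤-Reasoning

  blockInfl : ∀ n → (Vec (Fin k) n → Bool) → Fin n → ℕ
  blockInfl n A i = fsum m (λ j → infl (n * m) (λ x → A (lift n x)) (combine i j))

  -- Multiplied by U on the left, since only n − 1 of the n factors U are needed.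
  blockInfl≤ : ∀ n A i → U * blockInfl n A i ≤ 2 * 2 ^ m * (U ^ n * gridBoundary n A i)
  blockInfl≤ (suc n) A zero = begin
    U * blockInfl (suc n) A zero
      ≡⟨ cong (U *_) (fsum-summation m .∑-cong (infl-↑ˡ m (n * m) (λ x y → A (ψ x ∷ lift n y)))) ⟩
    U * fsum m (λ j → vsum bsum (n * m) (λ y → infl m (λ x → A (ψ x ∷ lift n y)) j))
      ≡⟨ cong (U *_) (fsum-summation m .∑-swap (vsum bsum (n * m)) (cube (n * m) .∑-+) (∑-0 (cube (n * m)))
           (λ j y → infl m (λ x → A (ψ x ∷ lift n y)) j)) ⟩
    U * vsum bsum (n * m) (λ y → fsum m (infl m (λ x → A (ψ x ∷ lift n y))))
      ≤⟨ *-monoʳ-≤ U (cube (n * m) .∑-mono (λ y → ≤-trans (line (λ i → A (i ∷ lift n y)))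
           (≤-reflexive (sym (*-assoc 2 (2 ^ m) (G (lift n y))))))) ⟩
    U * vsum bsum (n * m) (λ y → 2 * 2 ^ m * G (lift n y))
      ≡⟨ cong (U *_) (cube (n * m) .∑-* (2 * 2 ^ m) (λ y → G (lift n y))) ⟩
    U * (2 * 2 ^ m * vsum bsum (n * m) (λ y → G (lift n y)))
      ≤⟨ *-monoʳ-≤ U (*-monoʳ-≤ (2 * 2 ^ m) (lift-upper n G)) ⟩
    U * (2 * 2 ^ m * (U ^ n * vsum (fsum k) n G))
      ≡⟨ regroup U (2 * 2 ^ m) (U ^ n) (vsum (fsum k) n G) ⟩
    2 * 2 ^ m * (U ^ suc n * gridBoundary (suc n) A zero) ∎
    where
      open ≤-Reasoning
      G : Vec (Fin k) n → ℕ
      G v = lineBoundary k (λ i → A (i ∷ v))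
      abstract regroup : ∀ u c p s → u * (c * (p * s)) ≡ c * (u * p * s)
               regroup = solve-∀
  blockInfl≤ (suc n) A (suc i) = begin
    U * blockInfl (suc n) A (suc i)
      ≡⟨ cong (U *_) (fsum-summation m .∑-cong (λ j → infl-↑ʳ m (n * m) (λ x y → A (ψ x ∷ lift n y)) (combine i j))) ⟩
    U * fsum m (λ j → vsum bsum m (λ x → infl (n * m) (λ y → A (ψ x ∷ lift n y)) (combine i j)))
      ≡⟨ cong (U *_) (fsum-summation m .∑-swap (vsum bsum m) (cube m .∑-+) (∑-0 (cube m))
           (λ j x → infl (n * m) (λ y → A (ψ x ∷ lift n y)) (combine i j))) ⟩
    U * vsum bsum m (λ x → blockInfl n (λ v → A (ψ x ∷ v)) i)
      ≡⟨ cube m .∑-* U (λ x → blockInfl n (λ v → A (ψ x ∷ v)) i) ⟨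
    vsum bsum m (λ x → U * blockInfl n (λ v → A (ψ x ∷ v)) i)
      ≤⟨ cube m .∑-mono (λ x → blockInfl≤ n (λ v → A (ψ x ∷ v)) i) ⟩
    vsum bsum m (λ x → 2 * 2 ^ m * (U ^ n * G (ψ x)))
      ≤⟨ upper (λ a → 2 * 2 ^ m * (U ^ n * G a)) ⟩
    U * fsum k (λ a → 2 * 2 ^ m * (U ^ n * G a))
      ≡⟨ cong (U *_) (trans (fsum-summation k .∑-* (2 * 2 ^ m) (λ a → U ^ n * G a))
           (cong (2 * 2 ^ m *_) (fsum-summation k .∑-* (U ^ n) G))) ⟩
    U * (2 * 2 ^ m * (U ^ n * fsum k G))
      ≡⟨ regroup U (2 * 2 ^ m) (U ^ n) (fsum k G) ⟩
    2 * 2 ^ m * (U ^ suc n * gridBoundary (suc n) A (suc i)) ∎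
    where
      open ≤-Reasoning
      G : Fin k → ℕ
      G a = gridBoundary n (λ v → A (a ∷ v)) i
      abstract regroup : ∀ u c p s → u * (c * (p * s)) ≡ c * (u * p * s)
               regroup = solve-∀

-- Choice of the scale and transfer from cube to grid

power-blow-up : ∀ E Q r e → e ≤ E → 2 * E * r ≤ Q → E * (Q + r) ^ e ≤ (E + e) * Q ^ e
power-blow-up E Q r zero _ _ = ≤-reflexive (cong (_* 1) (sym (+-identityʳ E)))
power-blow-up E Q r (suc e) e<E small = begin
  E * ((Q + r) * (Q + r) ^ e)            ≡⟨ ident₁ E (Q + r) ((Q + r) ^ e) ⟩
  (Q + r) * (E * (Q + r) ^ e)            ≤⟨ *-monoʳ-≤ (Q + r) (power-blow-up E Q r e (<⇒≤ e<E) small) ⟩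
  (Q + r) * ((E + e) * Q ^ e)            ≡⟨ ident₂ Q r (E + e) (Q ^ e) ⟩
  ((E + e) * Q + (E + e) * r) * Q ^ e
    -- A new factor `Q + r` brings the extra term `(E + e) * r`, at most one `Q`. So the coefficient
    -- grows linearly, from `E` to `2 * E` over `E` factors.
    ≤⟨ *-monoˡ-≤ (Q ^ e) (+-monoʳ-≤ ((E + e) * Q) (≤-trans (*-monoˡ-≤ r E+e≤2E) small)) ⟩
  ((E + e) * Q + Q) * Q ^ e              ≡⟨ ident₃ Q E e (Q ^ e) ⟩
  (E + suc e) * (Q * Q ^ e) ∎
  where
    open ≤-Reasoning
    E+e≤2E : E + e ≤ 2 * E
    E+e≤2E = +-monoʳ-≤ E (≤-trans (<⇒≤ e<E) (m≤m+n E 0))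
    abstract
      ident₁ : ∀ E u p → E * (u * p) ≡ u * (E * p)
      ident₁ = solve-∀
      ident₂ : ∀ Q r s p → (Q + r) * (s * p) ≡ (s * Q + s * r) * p
      ident₂ = solve-∀
      ident₃ : ∀ Q E e p → ((E + e) * Q + Q) * p ≡ (E + (1 + e)) * (Q * p)
      ident₃ = solve-∀

power-blow-up-2 : ∀ n Q r → 2 * suc n * r ≤ Q → (Q + r) ^ suc n ≤ 2 * Q ^ suc n
power-blow-up-2 n Q r small = *-cancelˡ-≤ (suc n) (≤-trans (power-blow-up (suc n) Q r (suc n) ≤-refl small)
  (≤-reflexive (ident (suc n) (Q ^ suc n))))
  where abstract ident : ∀ n p → (n + n) * p ≡ n * (2 * p)
                 ident = solve-∀

fine-scale : ∀ k n → Σ ℕ λ m → Σ ℕ λ q → Σ ℕ λ r →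
  (2 ^ m ≡ suc k * suc q + r) × (2 * suc n * r ≤ suc q)
fine-scale k n = m , split (2 ^ m / suc k) refl
  where
    -- The remainder is below `suc k`, so a quotient of at least `X` suffices. As `2 ^ m > m`,
    -- taking `m = X * suc k` forces it.
    X = 2 * suc n * suc k
    m = X * suc k
    X≤ : X ≤ 2 ^ m / suc k
    X≤ = subst (_≤ 2 ^ m / suc k) (m*n/n≡m X (suc k)) (/-monoˡ-≤ (suc k) (<⇒≤ (n<2^n m)))
    split : ∀ Q → 2 ^ m / suc k ≡ Q → Σ ℕ λ q → Σ ℕ λ r →
      (2 ^ m ≡ suc k * suc q + r) × (2 * suc n * r ≤ suc q)
    split zero eq with () ← ≤-trans (s≤s z≤n) (subst (X ≤_) eq X≤)
    split (suc q) eq = q , 2 ^ m % suc k ,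
      trans (m≡m%n+[m/n]*n (2 ^ m) (suc k)) (trans (+-comm (2 ^ m % suc k) _)
        (cong (_+ 2 ^ m % suc k) (trans (cong (_* suc k) eq) (*-comm (suc q) (suc k))))) ,
      ≤-trans (*-monoʳ-≤ (2 * suc n) (<⇒≤ (m%n<n (2 ^ m) (suc k)))) (subst (X ≤_) eq X≤)

junta-grid : ∀ k n d (J : Vec Bool (suc n)) (A : Vec (Fin (suc k)) (suc n) → Bool) →
  (∀ i → lookup J i ≡ false → 16 ^ d * (4 * gridBoundary (suc n) A i) ≤ suc k ^ n) →
  suc k ^ n * (suc d * mixDis (fsum (suc k)) (suc n) J A) ≤
  16 * (suc k ^ suc n * suc k ^ suc n * fsum (suc n) (gridBoundary (suc n) A))
junta-grid k n d J A small with fine-scale k n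
... | m , q , r , N≡ , small-r = *-cancelˡ-≤ (L^n * L^n) (begin
  (L^n * L^n) * (κ * (suc d * W))
    ≡⟨ ident₁ L^n κ (suc d) W ⟩
  κ * (suc d * (L^n * (L^n * W)))
    ≤⟨ *-monoʳ-≤ κ (*-monoʳ-≤ (suc d) (mixDis-lift (suc n) J A)) ⟩
  κ * (suc d * mixDis bsum (suc n * m) (spread m J) (λ x → A (lift (suc n) x)))
    ≤⟨ *-monoʳ-≤ κ (junta-cube (suc n * m) d (spread m J) (λ x → A (lift (suc n) x)) small') ⟩
  κ * (2 ^ (suc n * m) * fsum (suc n * m) (infl (suc n * m) (λ x → A (lift (suc n) x))))
    ≡⟨ cong₂ (λ a b → κ * (a * b)) 2^nm≡ (fsum-combine (suc n) m _) ⟩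
  κ * (N^n * fsum (suc n) b)
    ≡⟨ ident₂ κ N^n (fsum (suc n) b) ⟩
  N^n * (κ * fsum (suc n) b)
    ≡⟨ cong (N^n *_) (fsum-summation (suc n) .∑-* κ b) ⟨
  N^n * fsum (suc n) (λ i → κ * b i)
    ≤⟨ *-monoʳ-≤ N^n (fsum-summation (suc n) .∑-mono block≤) ⟩
  N^n * fsum (suc n) (λ i → 4 * N^n * g i)
    ≡⟨ cong (N^n *_) (fsum-summation (suc n) .∑-* (4 * N^n) g) ⟩
  N^n * (4 * N^n * ∂A)
    -- The volume of the cube is at most twice `K^n * L^n`. It occurs twice, so 2 · 2 joins the 4 of
    -- `block≤` to give 16.
    ≤⟨ *-mono-≤ N^n≤ (*-monoˡ-≤ ∂A (*-monoʳ-≤ 4 N^n≤)) ⟩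
  (2 * (K^n * L^n)) * (4 * (2 * (K^n * L^n)) * ∂A)
    ≡⟨ ident₃ K^n L^n ∂A ⟩
  (L^n * L^n) * (16 * (K^n * K^n * ∂A)) ∎)
  where
    open ≤-Reasoning
    β = blowUp k m q r N≡
    open Lift β
    K = suc k
    L = suc q
    U = suc q + r
    N = 2 ^ m
    κ = K ^ n
    K^n = K ^ suc n
    L^n = L ^ suc n
    N^n = N ^ suc n
    g = gridBoundary (suc n) A
    ∂A = fsum (suc n) g
    b = blockInfl (suc n) A
    W = mixDis (fsum (suc k)) (suc n) J A
    instance
      _ : NonZero N
      _ = m^n≢0 2 m
      _ : NonZero κ
      _ = m^n≢0 K n
      L^n≢0 : NonZero L^n
      L^n≢0 = m^n≢0 L (suc n)
      _ : NonZero (L^n * L^n)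
      _ = m*n≢0 L^n L^n
    abstract
      ident₁ : ∀ l c s w → (l * l) * (c * (s * w)) ≡ c * (s * (l * (l * w)))
      ident₁ = solve-∀
      ident₂ : ∀ a b c → a * (b * c) ≡ b * (a * c)
      ident₂ = solve-∀
      ident₃ : ∀ p l s → (2 * (p * l)) * (4 * (2 * (p * l)) * s) ≡ (l * l) * (16 * (p * p * s))
      ident₃ = solve-∀
      ident₄ : ∀ k u c b → (k * u) * (c * b) ≡ (k * c) * (u * b)
      ident₄ = solve-∀
      ident₅ : ∀ p N l g → p * (2 * N * (2 * l * g)) ≡ N * (4 * (p * l) * g)
      ident₅ = solve-∀
      ident₆ : ∀ s N g → s * (4 * N * g) ≡ N * (s * (4 * g))
      ident₆ = solve-∀
    U^n≤ : U ^ suc n ≤ 2 * L^n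
    U^n≤ = power-blow-up-2 n L r small-r
    N≤KU : N ≤ K * U
    N≤KU = ≤-trans (≤-reflexive N≡) (≤-trans (+-monoʳ-≤ (K * L) (m≤n*m r K)) (≤-reflexive (sym (*-distribˡ-+ K L r))))
    KL≤N : K * L ≤ N
    KL≤N = ≤-trans (m≤m+n (K * L) r) (≤-reflexive (sym N≡))
    N^n≤ : N^n ≤ 2 * (K^n * L^n)
    N^n≤ = begin
      N ^ suc n               ≤⟨ ^-monoˡ-≤ (suc n) N≤KU ⟩
      (K * U) ^ suc n         ≡⟨ ^-distribʳ-* K U (suc n) ⟩
      K^n * U ^ suc n         ≤⟨ *-monoʳ-≤ K^n U^n≤ ⟩
      K^n * (2 * L^n)         ≡⟨ ident₂ K^n 2 L^n ⟩
      2 * (K^n * L^n) ∎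
    2^nm≡ : 2 ^ (suc n * m) ≡ N^n
    2^nm≡ = trans (cong (2 ^_) (*-comm (suc n) m)) (sym (^-*-assoc 2 m (suc n)))
    -- Both sides divided by volumes: the total influence of a block is at most 4 times the boundary
    -- density in its direction. One 2 is from the dyadic bound, the other from `U^n≤`.
    block≤ : ∀ i → κ * b i ≤ 4 * N^n * g i
    block≤ i = *-cancelˡ-≤ N (begin
      N * (κ * b i)                       ≤⟨ *-monoˡ-≤ (κ * b i) N≤KU ⟩
      (K * U) * (κ * b i)                 ≡⟨ ident₄ K U κ (b i) ⟩
      K^n * (U * b i)                     ≤⟨ *-monoʳ-≤ K^n (blockInfl≤ (suc n) A i) ⟩
      K^n * (2 * N * (U ^ suc n * g i))   ≤⟨ *-monoʳ-≤ K^n (*-monoʳ-≤ (2 * N) (*-monoˡ-≤ (g i) U^n≤)) ⟩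
      K^n * (2 * N * (2 * L^n * g i))     ≡⟨ ident₅ K^n N L^n (g i) ⟩
      N * (4 * (K^n * L^n) * g i)
        ≤⟨ *-monoʳ-≤ N (*-monoˡ-≤ (g i) (*-monoʳ-≤ 4 (≤-trans (≤-reflexive (sym (^-distribʳ-* K L (suc n))))
             (^-monoˡ-≤ (suc n) KL≤N)))) ⟩
      N * (4 * N^n * g i) ∎)
    small' : ∀ e → lookup (spread m J) e ≡ false →
      16 ^ d * infl (suc n * m) (λ x → A (lift (suc n) x)) e ≤ 2 ^ (suc n * m)
    small' e e∉J with combine-surjective {suc n} {m} e
    ... | i , j , refl = *-cancelˡ-≤ κ (begin
      κ * (16 ^ d * infl (suc n * m) (λ x → A (lift (suc n) x)) (combine i j))
        ≤⟨ *-monoʳ-≤ κ (*-monoʳ-≤ (16 ^ d) (term≤∑ (fsum-summation m)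
             (λ j → infl (suc n * m) (λ x → A (lift (suc n) x)) (combine i j)) j)) ⟩
      κ * (16 ^ d * b i)           ≡⟨ ident₂ κ (16 ^ d) (b i) ⟩
      16 ^ d * (κ * b i)           ≤⟨ *-monoʳ-≤ (16 ^ d) (block≤ i) ⟩
      16 ^ d * (4 * N^n * g i)     ≡⟨ ident₆ (16 ^ d) N^n (g i) ⟩
      N^n * (16 ^ d * (4 * g i))   ≤⟨ *-monoʳ-≤ N^n (small i (trans (sym (lookup-spread m J i j)) e∉J)) ⟩
      N^n * κ                      ≡⟨ *-comm N^n κ ⟩
      κ * N^n                      ≡⟨ cong (κ *_) 2^nm≡ ⟨
      κ * 2 ^ (suc n * m) ∎)

fsum-average : ∀ k (f : Fin (suc k) → ℕ) → ∃ λ i → suc k * f i ≤ fsum (suc k) f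
fsum-average zero f = zero , ≤-refl
fsum-average (suc k) f with fsum-average k (λ i → f (suc i))
... | i , p with ≤-total (f zero) (f (suc i))
... | inj₁ q = zero , +-monoʳ-≤ (f zero) (≤-trans (*-monoʳ-≤ (suc k) q) p)
... | inj₂ q = suc i , +-mono-≤ q p

vsum-average : ∀ k n (f : Vec (Fin (suc k)) n → ℕ) → ∃ λ v → suc k ^ n * f v ≤ vsum (fsum (suc k)) n f
vsum-average k zero f = [] , ≤-reflexive (*-identityˡ (f []))
vsum-average k (suc n) f with fsum-average k (λ i → vsum (fsum (suc k)) n (λ v → f (i ∷ v)))
... | i , p with vsum-average k n (λ v → f (i ∷ v))
... | v , q = i ∷ v , ≤-trans (≤-reflexive (*-assoc (suc k) (suc k ^ n) _)) (≤-trans (*-monoʳ-≤ (suc k) q) p)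

-- Edge boundary and juntas on the grid

sum-allFin : ∀ k (f : Fin k → ℕ) → sum (map f (allFin k)) ≡ fsum k f
sum-allFin k f = trans (cong sum (map-tabulate id f)) (sum-tabulate k f)
  where
    sum-tabulate : ∀ k (f : Fin k → ℕ) → sum (List.tabulate f) ≡ fsum k f
    sum-tabulate zero f = refl
    sum-tabulate (suc k) f = cong (f zero +_) (sum-tabulate k (f ∘ suc))

-- Follows the recursion of `sumAll` on cons cells, so that `sumAll` turns into `vsum` without
-- function extensionality.
point : ∀ {k n} → Vec (Fin k) n → Point k n
point [] = λ ()
point (i ∷ v) = i VF.∷ point v

tabulate-point : ∀ {k n} (v : Vec (Fin k) n) → tabulate (point v) ≡ v
tabulate-point [] = refl
tabulate-point (i ∷ v) = cong (i ∷_) (tabulate-point v)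

sumAll-vsum : ∀ {k} n (f : Point k n → ℕ) → sumAll n f ≡ vsum (fsum k) n (f ∘ point)
sumAll-vsum zero f = refl
sumAll-vsum {k} (suc n) f = trans (sum-allFin k _)
  (fsum-summation k .∑-cong (λ i → sumAll-vsum n (λ x → f (i VF.∷ x))))

module _ {k n : ℕ} (x y : Point k n) where

  adjacent-intro : ∀ j → T (∣ toℕ (x j) - toℕ (y j) ∣ ≡ᵇ 1) → (∀ i → i ≡ j ⊎ x i ≡ y i) → T (adjacent x y)
  adjacent-intro j step rest = any⁺ _ (lose (∈-allFin j)
    (Equivalence.from T-∧ (step , all⁻ _ (All.universal (λ i → Equivalence.from T-∨ (agree i (rest i))) (allFin n)))))
    where
      agree : ∀ i → i ≡ j ⊎ x i ≡ y i → T ⌊ i ≟ j ⌋ ⊎ T ⌊ x i ≟ y i ⌋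
      agree i (inj₁ p) = inj₁ (fromWitness p)
      agree i (inj₂ p) = inj₂ (fromWitness p)

  adjacent-elim : T (adjacent x y) →
    ∃ λ j → T (∣ toℕ (x j) - toℕ (y j) ∣ ≡ᵇ 1) × (∀ i → i ≡ j ⊎ x i ≡ y i)
  adjacent-elim p with Any.satisfied (any⁻ _ (allFin n) p)
  ... | j , q with Equivalence.to T-∧ q
  ... | step , rest = j , step , λ i → agree i (Equivalence.to T-∨ (All.lookup (all⁺ _ (allFin n) rest) (∈-allFin i)))
    where
      agree : ∀ i → T ⌊ i ≟ j ⌋ ⊎ T ⌊ x i ≟ y i ⌋ → i ≡ j ⊎ x i ≡ y i
      agree i (inj₁ p) = inj₁ (toWitness p)
      agree i (inj₂ p) = inj₂ (toWitness p)

adjacent-tail : ∀ {k n} i (v w : Vec (Fin k) n) →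
  T (adjacent (point v) (point w)) → T (adjacent (point (i ∷ v)) (point (i ∷ w)))
adjacent-tail i v w p with adjacent-elim (point v) (point w) p
... | j , step , rest = adjacent-intro (point (i ∷ v)) (point (i ∷ w)) (suc j) step agree
  where
    agree : ∀ l → l ≡ suc j ⊎ point (i ∷ v) l ≡ point (i ∷ w) l
    agree zero = inj₂ refl
    agree (suc l) with rest l
    ... | inj₁ q = inj₁ (cong suc q)
    ... | inj₂ q = inj₂ q

adjacent-head : ∀ {k n} i j (v : Vec (Fin k) n) →
  T (∣ toℕ i - toℕ j ∣ ≡ᵇ 1) → T (adjacent (point (i ∷ v)) (point (j ∷ v)))
adjacent-head i j v step = adjacent-intro (point (i ∷ v)) (point (j ∷ v)) zero step agree
  where
    agree : ∀ l → l ≡ zero ⊎ point (i ∷ v) l ≡ point (j ∷ v) l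
    agree zero = inj₁ refl
    agree (suc l) = inj₂ refl

⟦⟧-mono : ∀ a b {c d} → (T c → T d) → ⟦ a ∧ b ∧ c ⟧ ≤ ⟦ a ∧ b ∧ d ⟧
⟦⟧-mono false b p = z≤n
⟦⟧-mono true false p = z≤n
⟦⟧-mono true true {false} p = z≤n
⟦⟧-mono true true {true} {true} p = ≤-refl
⟦⟧-mono true true {true} {false} p with () ← p _

boundary : ∀ {k} n → (Vec (Fin k) n → Bool) → ℕ
boundary {k} n A = vsum (fsum k) n (λ v → vsum (fsum k) n (λ w →
  ⟦ A v ∧ not (A w) ∧ adjacent (point v) (point w) ⟧))

-- For a fixed first point `i ∷ v`, edges along the first axis keep the tail `v` and change the
-- head, while all others keep the head `i`; the two families occupy different terms of the boundary
-- sum.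
gridBoundary≤ : ∀ {k} n (A : Vec (Fin k) n → Bool) → fsum n (gridBoundary n A) ≤ boundary n A
gridBoundary≤ zero A = z≤n
gridBoundary≤ {k} (suc n) A = begin
  grid (λ v → lineBoundary k (λ i → A (i ∷ v))) + fsum n (λ e → F (λ i → gridBoundary n (λ v → A (i ∷ v)) e))
    ≡⟨ cong₂ _+_ (gridS .∑-swap F (FS .∑-+) (∑-0 FS) (λ v i → F (λ j → along i v j)))
         (fsum-summation n .∑-swap F (FS .∑-+) (∑-0 FS) (λ e i → gridBoundary n (λ v → A (i ∷ v)) e)) ⟩
  F (λ i → grid (λ v → F (along i v))) + F (λ i → fsum n (gridBoundary n (λ v → A (i ∷ v))))
    ≤⟨ +-monoʳ-≤ (F (λ i → grid (λ v → F (along i v)))) (FS .∑-mono (λ i → gridBoundary≤ n (λ v → A (i ∷ v)))) ⟩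
  F (λ i → grid (λ v → F (along i v))) + F (λ i → grid (λ v → within i v))
    ≡⟨ FS .∑-+ (λ i → grid (λ v → F (along i v))) (λ i → grid (within i)) ⟨
  F (λ i → grid (λ v → F (along i v)) + grid (within i))
    ≡⟨ FS .∑-cong (λ i → gridS .∑-+ (λ v → F (along i v)) (within i)) ⟨
  F (λ i → grid (λ v → F (along i v) + within i v))
    ≤⟨ FS .∑-mono (λ i → gridS .∑-mono (λ v → both i v)) ⟩
  boundary (suc n) A ∎
  where
    open ≤-Reasoning
    F = fsum k
    FS = fsum-summation k
    grid = vsum (fsum k) n
    gridS = vsum-summation FS n
    along : Fin k → Vec (Fin k) n → Fin k → ℕ
    along i v j = ⟦ A (i ∷ v) ∧ not (A (j ∷ v)) ∧ (∣ toℕ i - toℕ j ∣ ≡ᵇ 1) ⟧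
    within : Fin k → Vec (Fin k) n → ℕ
    within i v = grid (λ w → ⟦ A (i ∷ v) ∧ not (A (i ∷ w)) ∧ adjacent (point v) (point w) ⟧)
    row : Fin k → Vec (Fin k) n → Fin k → ℕ
    row i v j = grid (λ w → ⟦ A (i ∷ v) ∧ not (A (j ∷ w)) ∧ adjacent (point (i ∷ v)) (point (j ∷ w)) ⟧)
    -- Places the edges that keep the head at `j = i`, where `along` vanishes; the two contributions
    -- can then be compared with `row` term by term.
    diagonal : Fin k → Vec (Fin k) n → Fin k → ℕ
    diagonal i v j = if ⌊ i ≟ j ⌋ then within i v else 0
    diagonal-refl : ∀ i v → within i v ≡ diagonal i v i
    diagonal-refl i v with i ≟ i
    ... | yes _ = refl
    ... | no i≢i with () ← i≢i refl
    along-refl : ∀ i v → along i v i ≡ 0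
    along-refl i v rewrite ∣n-n∣≡0 (toℕ i) with A (i ∷ v)
    ... | true = refl
    ... | false = refl
    split : ∀ i v j (i≟j : Dec (i ≡ j)) → along i v j + (if ⌊ i≟j ⌋ then within i v else 0) ≤ row i v j
    split i v j (yes refl) = ≤-trans (≤-reflexive (cong (_+ within i v) (along-refl i v)))
      (gridS .∑-mono (λ w → ⟦⟧-mono (A (i ∷ v)) (not (A (i ∷ w))) (adjacent-tail i v w)))
    split i v j (no _) = ≤-trans (≤-reflexive (+-identityʳ (along i v j)))
      (≤-trans (⟦⟧-mono (A (i ∷ v)) (not (A (j ∷ v))) (adjacent-head i j v))
        (term≤∑ gridS (λ w → ⟦ A (i ∷ v) ∧ not (A (j ∷ w)) ∧ adjacent (point (i ∷ v)) (point (j ∷ w)) ⟧) v))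
    both : ∀ i v → F (along i v) + within i v ≤ F (row i v)
    both i v = begin
      F (along i v) + within i v
        ≤⟨ +-monoʳ-≤ (F (along i v)) (≤-trans (≤-reflexive (diagonal-refl i v)) (term≤∑ FS (diagonal i v) i)) ⟩
      F (along i v) + F (diagonal i v)
        ≡⟨ FS .∑-+ (along i v) (diagonal i v) ⟨
      F (λ j → along i v j + diagonal i v j)
        ≤⟨ FS .∑-mono (λ j → split i v j (i ≟ j)) ⟩
      F (row i v) ∎

boundary≡boundarySize : ∀ {k} n (A : Point k n → Bool) → boundary n (A ∘ point) ≡ boundarySize n A
boundary≡boundarySize {k} n A = sym (trans (sumAll-vsum n _)
  (vsum-summation (fsum-summation k) n .∑-cong (λ v → sumAll-vsum n _)))

disagree≡ : ∀ {k} n (A g : Point k n → Bool) →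
  disagree n A g ≡ vsum (fsum k) n (λ v → ⟦ A (point v) xor g (point v) ⟧)
disagree≡ {k} n A g = trans (sumAll-vsum n _)
  (vsum-summation (fsum-summation k) n .∑-cong (λ v → differ (A (point v)) (g (point v))))
  where
    differ : ∀ a b → ⟦ not ⌊ a Bool.≟ b ⌋ ⟧ ≡ ⟦ a xor b ⟧
    differ true true = refl
    differ true false = refl
    differ false true = refl
    differ false false = refl

∣∣≡fsum : ∀ {n} (J : Subset n) → ∣ J ∣ ≡ fsum n (λ i → ⟦ lookup J i ⟧)
∣∣≡fsum [] = refl
∣∣≡fsum (true ∷ J) = cong suc (∣∣≡fsum J)
∣∣≡fsum (false ∷ J) = ∣∣≡fsum J

mix-cong : ∀ {n} {X : Set} (J : Vec Bool n) (x y z : Vec X n) →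
  (∀ i → i ∈ₛ J → lookup x i ≡ lookup y i) → mix J x z ≡ mix J y z
mix-cong [] [] [] [] p = refl
mix-cong (true ∷ J) (a ∷ x) (b ∷ y) (c ∷ z) p =
  cong₂ _∷_ (p zero here) (mix-cong J x y z (λ i i∈J → p (suc i) (there i∈J)))
mix-cong (false ∷ J) (a ∷ x) (b ∷ y) (c ∷ z) p =
  cong (c ∷_) (mix-cong J x y z (λ i i∈J → p (suc i) (there i∈J)))

mix-junta : ∀ {k n} (J : Subset n) (A : Vec (Fin k) n → Bool) z →
  IsJunta ∣ J ∣ (λ (x : Point k n) → A (mix J (tabulate x) z))
mix-junta J A z = J , refl , λ x y x≡y → cong A (mix-cong J (tabulate x) (tabulate y) z (λ i i∈J →
  trans (lookup∘tabulate x i) (trans (x≡y i i∈J) (sym (lookup∘tabulate y i)))))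

-- Selecting the coordinates and bounding their number

heavy : ∀ {n} → ℕ → (Fin n → ℕ) → Subset n
heavy κ w = tabulate (λ i → ⌊ κ ≤? w i ⌋)

-- Markov's inequality.
∣heavy∣ : ∀ {n} κ (w : Fin n → ℕ) → κ * ∣ heavy κ w ∣ ≤ fsum n w
∣heavy∣ {n} κ w = begin
  κ * ∣ heavy κ w ∣                                ≡⟨ cong (κ *_) (∣∣≡fsum (heavy κ w)) ⟩
  κ * fsum n (λ i → ⟦ lookup (heavy κ w) i ⟧)      ≡⟨ fsum-summation n .∑-* κ _ ⟨
  fsum n (λ i → κ * ⟦ lookup (heavy κ w) i ⟧)
    ≡⟨ fsum-summation n .∑-cong (λ i → cong (λ b → κ * ⟦ b ⟧) (lookup∘tabulate (λ i → ⌊ κ ≤? w i ⌋) i)) ⟩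
  fsum n (λ i → κ * ⟦ ⌊ κ ≤? w i ⌋ ⟧)              ≤⟨ fsum-summation n .∑-mono bound ⟩
  fsum n w ∎
  where
    open ≤-Reasoning
    bound : ∀ i → κ * ⟦ ⌊ κ ≤? w i ⌋ ⟧ ≤ w i
    bound i with κ ≤? w i
    ... | yes p = ≤-trans (≤-reflexive (*-identityʳ κ)) p
    ... | no _ = ≤-trans (≤-reflexive (*-zeroʳ κ)) z≤n

light : ∀ {n} κ (w : Fin n → ℕ) i → lookup (heavy κ w) i ≡ false → w i ≤ κ
light κ w i eq with κ ≤? w i | trans (sym (lookup∘tabulate (λ i → ⌊ κ ≤? w i ⌋) i)) eq
... | no p | _ = <⇒≤ (≰⇒> p)

m<n*[1+m/n] : ∀ m n .{{_ : NonZero n}} → m < n * suc (m / n)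
m<n*[1+m/n] m n = begin-strict
  m                        ≡⟨ m≡m%n+[m/n]*n m n ⟩
  m % n + m / n * n        <⟨ +-monoˡ-< (m / n * n) (m%n<n m n) ⟩
  suc (m / n) * n          ≡⟨ *-comm (suc (m / n)) n ⟩
  n * suc (m / n) ∎
  where open ≤-Reasoning

-- The bound on `κ * M` gives `M ≤ 2 ^ (4 * d + s)`, where `s` is the quotient of `4 * ∂` by `κ` and
-- `suc s ≤ 2 ^ s` absorbs the polynomial factor. In the exponent `4 * d` yields 64 and `s` yields
-- 4.
exponential-bound : ∀ κ a b d ∂ M .{{_ : NonZero κ}} → a ≤ b →
  d * (a * κ) ≤ 16 * ∂ * b → κ * M ≤ 16 ^ d * (4 * ∂) → M ^ (κ * a) ≤ 2 ^ (68 * ∂ * b)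
exponential-bound κ a b d ∂ M a≤b d≤ M≤ = begin
  M ^ (κ * a)                          ≤⟨ ^-monoˡ-≤ (κ * a) M≤2^ ⟩
  (2 ^ (4 * d + s)) ^ (κ * a)          ≡⟨ ^-*-assoc 2 (4 * d + s) (κ * a) ⟩
  2 ^ ((4 * d + s) * (κ * a))          ≤⟨ ^-monoʳ-≤ 2 exponent ⟩
  2 ^ (68 * ∂ * b) ∎
  where
    open ≤-Reasoning
    s = 4 * ∂ / κ
    M≤2^ : M ≤ 2 ^ (4 * d + s)
    M≤2^ = *-cancelˡ-≤ κ (begin
      κ * M                       ≤⟨ M≤ ⟩
      16 ^ d * (4 * ∂)            ≤⟨ *-monoʳ-≤ (16 ^ d) (<⇒≤ (m<n*[1+m/n] (4 * ∂) κ)) ⟩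
      16 ^ d * (κ * suc s)        ≤⟨ *-monoʳ-≤ (16 ^ d) (*-monoʳ-≤ κ (n<2^n s)) ⟩
      16 ^ d * (κ * 2 ^ s)        ≡⟨ ident (16 ^ d) κ (2 ^ s) ⟩
      κ * (16 ^ d * 2 ^ s)        ≡⟨ cong (λ z → κ * (z * 2 ^ s)) (^-*-assoc 2 4 d) ⟩
      κ * (2 ^ (4 * d) * 2 ^ s)   ≡⟨ cong (κ *_) (^-distribˡ-+-* 2 (4 * d) s) ⟨
      κ * 2 ^ (4 * d + s) ∎)
      where abstract ident : ∀ a b c → a * (b * c) ≡ b * (a * c)
                     ident = solve-∀
    exponent : (4 * d + s) * (κ * a) ≤ 68 * ∂ * b
    exponent = begin
      (4 * d + s) * (κ * a)                   ≡⟨ ident₁ d s κ a ⟩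
      -- The second summand is at most `4 * ∂ * a`; here ε ≤ 1, that is `a ≤ b`, turns `a` into `b`.
      4 * (d * (a * κ)) + s * κ * a           ≤⟨ +-mono-≤ (*-monoʳ-≤ 4 d≤) (*-mono-≤ (m/n*n≤m (4 * ∂) κ) a≤b) ⟩
      4 * (16 * ∂ * b) + 4 * ∂ * b            ≡⟨ ident₂ ∂ b ⟩
      68 * ∂ * b ∎
      where
        abstract
          ident₁ : ∀ d s κ a → (4 * d + s) * (κ * a) ≡ 4 * (d * (a * κ)) + s * κ * a
          ident₁ = solve-∀
          ident₂ : ∀ ∂ b → 4 * (16 * ∂ * b) + 4 * ∂ * b ≡ 68 * ∂ * b
          ident₂ = solve-∀

junta : ∀ k n (A : Point (suc k) (suc n) → Bool) a b → 1 ≤ a → a ≤ b →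
  Σ (Point (suc k) (suc n) → Bool) λ g → Σ ℕ λ M →
    IsJunta M g
    × (b * disagree (suc n) A g ≤ a * suc k ^ suc n)
    × (M ^ (suc k ^ n * a) ≤ 2 ^ (68 * boundarySize (suc n) A * b))
junta k n A a b 1≤a a≤b = g , ∣ J ∣ , mix-junta J B z , close , size
  where
    open ≤-Reasoning
    K = suc k
    κ = K ^ n
    K^n = K ^ suc n
    B : Vec (Fin K) (suc n) → Bool
    B = A ∘ point
    ∂ = boundarySize (suc n) A
    w = gridBoundary (suc n) B
    instance
      _ : NonZero a
      _ = >-nonZero 1≤a
      _ : NonZero κ
      _ = m^n≢0 K n
      aκ≢0 : NonZero (a * κ)
      aκ≢0 = m*n≢0 a κ
      _ : NonZero K^n
      _ = m^n≢0 K (suc n)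
    -- Rounded down, so that `d` is small enough for the size bound while `suc d` exceeds the exact
    -- ratio, as the error bound requires.
    d = 16 * ∂ * b / (a * κ)
    J : Subset (suc n)
    -- The threshold is the smallness hypothesis of `junta-grid`, read in the complement of `J`.
    J = heavy κ (λ i → 16 ^ d * (4 * w i))
    grid = vsum (fsum K) (suc n)
    gridS = vsum-summation (fsum-summation K) (suc n)
    error : Vec (Fin K) (suc n) → ℕ
    error z = grid (λ v → ⟦ B v xor B (mix J v z) ⟧)
    average = vsum-average k (suc n) error
    z = proj₁ average
    g : Point K (suc n) → Bool
    g x = B (mix J (tabulate x) z)
    w≤∂ : fsum (suc n) w ≤ ∂
    w≤∂ = ≤-trans (gridBoundary≤ (suc n) B) (≤-reflexive (boundary≡boundarySize (suc n) A))
    size : ∣ J ∣ ^ (κ * a) ≤ 2 ^ (68 * ∂ * b)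
    size = exponential-bound κ a b d ∂ ∣ J ∣ a≤b (m/n*n≤m (16 * ∂ * b) (a * κ)) (begin
      κ * ∣ J ∣                                           ≤⟨ ∣heavy∣ κ (λ i → 16 ^ d * (4 * w i)) ⟩
      fsum (suc n) (λ i → 16 ^ d * (4 * w i))             ≡⟨ fsum-summation (suc n) .∑-* (16 ^ d) (λ i → 4 * w i) ⟩
      16 ^ d * fsum (suc n) (λ i → 4 * w i)               ≡⟨ cong (16 ^ d *_) (fsum-summation (suc n) .∑-* 4 w) ⟩
      16 ^ d * (4 * fsum (suc n) w)                       ≤⟨ *-monoʳ-≤ (16 ^ d) (*-monoʳ-≤ 4 w≤∂) ⟩
      16 ^ d * (4 * ∂) ∎)
    error≡ : disagree (suc n) A g ≡ error z
    error≡ = trans (disagree≡ (suc n) A g)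
      (gridS .∑-cong (λ v → cong (λ x → ⟦ B v xor B (mix J x z) ⟧) (tabulate-point v)))
    mixDis≡ : mixDis (fsum K) (suc n) J B ≡ grid error
    -- With `z` summed last, averaging selects a single `z` that serves all `v`.
    mixDis≡ = gridS .∑-swap grid (gridS .∑-+) (∑-0 gridS) (λ v z → ⟦ B v xor B (mix J v z) ⟧)
    error≤ : κ * (suc d * error z) ≤ 16 * (K^n * ∂)
    error≤ = *-cancelˡ-≤ K^n (begin
      K^n * (κ * (suc d * error z))       ≡⟨ ident₁ K^n κ (suc d) (error z) ⟩
      κ * (suc d * (K^n * error z))       ≤⟨ *-monoʳ-≤ κ (*-monoʳ-≤ (suc d) (proj₂ average)) ⟩
      κ * (suc d * grid error)            ≡⟨ cong (λ t → κ * (suc d * t)) mixDis≡ ⟨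
      κ * (suc d * mixDis (fsum K) (suc n) J B)
        ≤⟨ junta-grid k n d J B (λ i → light κ (λ i → 16 ^ d * (4 * w i)) i) ⟩
      16 * (K^n * K^n * fsum (suc n) w)   ≤⟨ *-monoʳ-≤ 16 (*-monoʳ-≤ (K^n * K^n) w≤∂) ⟩
      16 * (K^n * K^n * ∂)                ≡⟨ ident₂ K^n ∂ ⟩
      K^n * (16 * (K^n * ∂)) ∎)
      where
        abstract
          ident₁ : ∀ p c s e → p * (c * (s * e)) ≡ c * (s * (p * e))
          ident₁ = solve-∀
          ident₂ : ∀ p s → 16 * (p * p * s) ≡ p * (16 * (p * s))
          ident₂ = solve-∀
    instance
      _ : NonZero (κ * suc d)
      _ = m*n≢0 κ (suc d)
    close : b * disagree (suc n) A g ≤ a * K^n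
    close = *-cancelˡ-≤ (κ * suc d) (begin
      (κ * suc d) * (b * disagree (suc n) A g)   ≡⟨ cong (λ e → (κ * suc d) * (b * e)) error≡ ⟩
      (κ * suc d) * (b * error z)                ≡⟨ ident₁ κ (suc d) b (error z) ⟩
      b * (κ * (suc d * error z))                ≤⟨ *-monoʳ-≤ b error≤ ⟩
      b * (16 * (K^n * ∂))                       ≡⟨ ident₂ b K^n ∂ ⟩
      K^n * (16 * ∂ * b)                         ≤⟨ *-monoʳ-≤ K^n (<⇒≤ (m<n*[1+m/n] (16 * ∂ * b) (a * κ))) ⟩
      K^n * (a * κ * suc d)                      ≡⟨ ident₃ K^n a κ (suc d) ⟩
      (κ * suc d) * (a * K^n) ∎)
      where
        abstract
          ident₁ : ∀ c s b e → (c * s) * (b * e) ≡ b * (c * (s * e))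
          ident₁ = solve-∀
          ident₂ : ∀ b p s → b * (16 * (p * s)) ≡ p * (16 * s * b)
          ident₂ = solve-∀
          ident₃ : ∀ p a c s → p * (a * c * s) ≡ (c * s) * (a * p)
          ident₃ = solve-∀

-- The range ε ≥ 1 and the conclusion

grid-const : ∀ k n c → vsum (fsum k) n (λ _ → c) ≡ k ^ n * c
grid-const k zero c = sym (*-identityˡ c)
grid-const k (suc n) c = trans (fsum-summation k .∑-cong (λ _ → grid-const k n c))
  (trans (fsum-const k (k ^ n * c)) (sym (*-assoc k (k ^ n) c)))
  where
    fsum-const : ∀ k c → fsum k (λ _ → c) ≡ k * c
    fsum-const zero c = refl
    fsum-const (suc k) c = cong (c +_) (fsum-const k c)

disagree≤ : ∀ {k} n (A g : Point k n → Bool) → disagree n A g ≤ k ^ n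
disagree≤ {k} n A g = begin
  disagree n A g                                               ≡⟨ disagree≡ n A g ⟩
  vsum (fsum k) n (λ v → ⟦ A (point v) xor g (point v) ⟧)
    ≤⟨ vsum-summation (fsum-summation k) n .∑-mono (λ v → ≤1 (A (point v) xor g (point v))) ⟩
  vsum (fsum k) n (λ _ → 1)                                    ≡⟨ grid-const k n 1 ⟩
  k ^ n * 1                                                    ≡⟨ *-identityʳ (k ^ n) ⟩
  k ^ n ∎
  where
    open ≤-Reasoning
    ≤1 : ∀ c → ⟦ c ⟧ ≤ 1
    ≤1 true = ≤-refl
    ≤1 false = z≤n

0^n≤ : ∀ n c .{{_ : NonZero n}} → 0 ^ n ≤ c
0^n≤ (suc n) c = z≤n

-- Here ε is `a / b`, and the bound on M is raised to the power `k ^ (n - 1) * a` to clear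
-- denominators. The base 2 in place of e makes it stronger.
theorem3 : Σ ℕ (λ C → ∀ (k n : ℕ) → 2 ≤ k → 1 ≤ n →
    (A : Point k n → Bool) → (a b : ℕ) → 1 ≤ a → 1 ≤ b →
    Σ (Point k n → Bool) (λ g → Σ ℕ (λ M →
    IsJunta M g
    × (b * disagree n A g ≤ a * k ^ n)
    × (M ^ (k ^ (n ∸ 1) * a) ≤ 2 ^ (C * boundarySize n A * b)))))
theorem3 = 68 , main
  where
    main : ∀ (k n : ℕ) → 2 ≤ k → 1 ≤ n →
      (A : Point k n → Bool) → (a b : ℕ) → 1 ≤ a → 1 ≤ b →
      Σ (Point k n → Bool) (λ g → Σ ℕ (λ M →
      IsJunta M g
      × (b * disagree n A g ≤ a * k ^ n)
      × (M ^ (k ^ (n ∸ 1) * a) ≤ 2 ^ (68 * boundarySize n A * b))))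
    main (suc k) (suc n) _ _ A a b 1≤a _ with ≤-total a b
    ... | inj₁ a≤b = junta k n A a b 1≤a a≤b
    -- For ε ≥ 1 the constant `false` on no coordinates is close enough. The exponent must be shown
    -- nonzero, since `0 ^ 0` is 1.
    ... | inj₂ b≤a = (λ _ → false) , 0 , (⊥ , ∣⊥∣≡0 (suc n) , λ _ _ _ → refl) ,
      *-mono-≤ b≤a (disagree≤ (suc n) A (λ _ → false)) ,
      0^n≤ (suc k ^ n * a) _ {{m*n≢0 (suc k ^ n) a {{m^n≢0 (suc k) n}} {{>-nonZero 1≤a}}}}
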